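{- The interaction system of the linear $\lambda$-calculus, i.e. the interaction system with agent types $@$ and $\lambda$, both of arity $2$, whose only interaction rule is $@[x,y]\bowtie\lambda[x,y]$, is upward confluent.
   Context: Interaction calculus. A signature $\Sigma$ is a set of agent types, each $\alpha\in\Sigma$ with an arity $\operatorname{ar}(\alpha)\ge 0$. Terms are given by $t ::= x \mid \alpha(t_1,\dots,t_n)$ with $x$ a name and $n=\operatorname{ar}(\alpha)$. An equation $t=u$ is an unordered pair of terms. A configuration $\langle \vec f \mid \Delta\rangle$ consists of a finite sequence of terms $\vec f$ (the interface) and a finite unordered multiset $\Delta$ of equations, where each name occurs at most twice in the whole configuration; configurations are considered up to $\alpha$-conversion (simultaneous renaming of both occurrences of a name to a name not otherwise occurring). An interaction rule is written $\alpha[v_1,\dots,v_m]\bowtie\beta[w_1,\dots,w_n]$ with $m=\operatorname{ar}(\alpha)$, $n=\operatorname{ar}(\beta)$ and $v_i,w_j$ terms in which each name of the rule occurs exactly twice; $\alpha[\vec v]\bowtie\beta[\vec w]$ is the same rule as $\beta[\vec w]\bowtie\alpha[\vec v]$. An interaction system is a signature with a set of interaction rules, at most one for each unordered pair of agent types. Reduction $\rightarrow$ on configurations consists of two kinds of steps. Interaction: for a rule $\alpha[v_1,\dots,v_m]\bowtie\beta[w_1,\dots,w_n]$ with names chosen fresh, $\langle \vec f \mid \alpha(t_1,\dots,t_m)=\beta(u_1,\dots,u_n),\ \Delta\rangle \rightarrow \langle \vec f \mid t_1=v_1,\dots,t_m=v_m,\ u_1=w_1,\dots,u_n=w_n,\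 \Delta\rangle$. (For the rule $@[x,y]\bowtie\lambda[x,y]$: $\langle \vec f \mid @(t_1,t_2)=\lambda(u_1,u_2),\ \Delta\rangle \rightarrow \langle \vec f \mid t_1=x,\ t_2=y,\ u_1=x,\ u_2=y,\ \Delta\rangle$ with $x,y$ fresh.) Indirection: if a configuration contains an equation $x=u$ where the name $x$ does not occur in $u$ and has its other occurrence elsewhere (in the interface or in another equation), remove the equation $x=u$ and replace the other occurrence of $x$ by $u$; substitution in the interface is included. An interaction system is upward confluent if and only if for all configurations $s_1,s_2,s$ with $s_1\rightarrow^* s$ and $s_2\rightarrow^* s$ there exists a configuration $s'$ with $s'\rightarrow^* s_1$ and $s'\rightarrow^* s_2$, where $\rightarrow^*$ is the reflexive transitive closure of $\rightarrow$. -}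

module Defs where

open import Data.List using (List; []; _∷_; _++_; map; concatMap; filter; length)
open import Data.List.Membership.Propositional using (_∈_; _∉_)
open import Data.List.Relation.Binary.Permutation.Propositional using (_↭_)
open import Data.Nat using (ℕ; _≤_; _≟_)
open import Data.Product using (_×_; ∃-syntax)
open import Data.Sum using (_⊎_)
open import Data.Unit using (⊤)
open import Data.Vec using (Vec; []; _∷_; toList; zipWith)
open import Function using (_∘_; _on_)
open import Relation.Binary using (Rel)
open import Relation.Binary.Construct.Closure.Equivalence using (EqClosure)
open import Relation.Binary.Construct.Closure.ReflexiveTransitive using (Star)
open import Relation.Binary.Construct.Union using (_∪_)
open import Relation.Binary.PropositionalEquality using (_≡_; refl)
open import Relation.Nullary using (yes; no)
import Level

Name : Set
Name = ℕ

occurrences : Name → List Name → ℕ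
occurrences x ns = length (filter (x ≟_) ns)

record Signature : Set₁ where
  field
    Agent : Set
    arity : Agent → ℕ

module Terms (Sig : Signature) where
  open Signature Sig public

  data Term : Set where
    var   : Name → Term
    agent : (α : Agent) → Vec Term (arity α) → Term

  -- All occurrences of names, with multiplicity.
  names  : Term → List Name
  namesᵛ : ∀ {n} → Vec Term n → List Name

  names (var x)      = x ∷ []
  names (agent α ts) = namesᵛ ts

  namesᵛ []       = []
  namesᵛ (t ∷ ts) = names t ++ namesᵛ ts

  subst  : (Name → Term) → Term → Term
  substᵛ : ∀ {n} → (Name → Term) → Vec Term n → Vec Term n

  subst σ (var x)      = σ x
  subst σ (agent α ts) = agent α (substᵛ σ ts)

  substᵛ σ []       = []
  substᵛ σ (t ∷ ts) = subst σ t ∷ substᵛ σ ts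

  infix 20 _↦_

  _↦_ : Name → Term → Name → Term
  (x ↦ u) y with x ≟ y
  ... | yes _ = u
  ... | no  _ = var y

  -- Equations are stored as ordered pairs and multisets as lists; the
  -- relation _≈_ below makes both unordered.
  infix 5 _≐_

  data Equation : Set where
    _≐_ : Term → Term → Equation

  namesᵉ : Equation → List Name
  namesᵉ (t ≐ u) = names t ++ names u

  substᵉ : (Name → Term) → Equation → Equation
  substᵉ σ (t ≐ u) = subst σ t ≐ subst σ u

  record PreConfiguration : Set where
    constructor ⟨_∣_⟩
    field
      interface : List Term
      equations : List Equation

  namesᶜ : PreConfiguration → List Name
  namesᶜ ⟨ f ∣ Δ ⟩ = concatMap names f ++ concatMap namesᵉ Δ

  substᶜ : (Name → Term) → PreConfiguration → PreConfiguration
  substᶜ σ ⟨ f ∣ Δ ⟩ = ⟨ map (subst σ) f ∣ map (substᵉ σ) Δ ⟩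

  record Configuration : Set where
    field
      pre         : PreConfiguration
      atMostTwice : ∀ x → occurrences x (namesᶜ pre) ≤ 2

  open Configuration public using (pre)

  data _≈ᵖ_ : Rel PreConfiguration Level.zero where
    permute : ∀ {f Δ Δ′} → Δ ↭ Δ′ → ⟨ f ∣ Δ ⟩ ≈ᵖ ⟨ f ∣ Δ′ ⟩
    flip    : ∀ {f t u Δ} → ⟨ f ∣ (t ≐ u) ∷ Δ ⟩ ≈ᵖ ⟨ f ∣ (u ≐ t) ∷ Δ ⟩
    alpha   : ∀ {c x y} → occurrences x (namesᶜ c) ≡ 2 → y ∉ namesᶜ c →
              c ≈ᵖ substᶜ (x ↦ var y) c

  -- The identification of configurations: those related by _≈_ are
  -- the same configuration.
  infix 4 _≈_ _≈ᵖ_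

  _≈_ : Rel Configuration Level.zero
  _≈_ = EqClosure (_≈ᵖ_ on pre)

  record Rule : Set where
    field
      left right   : Agent
      leftTerms    : Vec Term (arity left)
      rightTerms   : Vec Term (arity right)

    ruleNames : List Name
    ruleNames = namesᵛ leftTerms ++ namesᵛ rightTerms

    field
      exactlyTwice : ∀ x → x ∈ ruleNames → occurrences x ruleNames ≡ 2

  SamePair : Rel Rule Level.zero
  SamePair r r′ = (left r ≡ left r′ × right r ≡ right r′)
                ⊎ (left r ≡ right r′ × right r ≡ left r′)
    where open Rule

-- Each rule is stored in one of its two orientations; since equations
-- are unordered, it applies to active pairs in either orientation.
record InteractionSystem : Set₁ where
  field
    signature : Signature

  open Terms signature public

  field
    RuleIndex  : Set
    rule       : RuleIndex → Rule
    atMostOne  : ∀ i j → SamePair (rule i) (rule j) → i ≡ j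

module Reduction (S : InteractionSystem) where
  open InteractionSystem S
  open Rule

  record FreshRenaming (r : Rule) (c : PreConfiguration)
                       (ρ : Name → Name) : Set where
    field
      injective : ∀ {x y} → x ∈ ruleNames r → y ∈ ruleNames r →
                  ρ x ≡ ρ y → x ≡ y
      fresh     : ∀ {x} → x ∈ ruleNames r → ρ x ∉ namesᶜ c

  infix 4 _⟶ᵖ_ _⟶_ _⟶*_

  data _⟶ᵖ_ : Rel PreConfiguration Level.zero where
    interaction :
      ∀ {f Δ} (i : RuleIndex) →
      let r = rule i in
      (ts : Vec Term (arity (left r))) (us : Vec Term (arity (right r)))
      (ρ : Name → Name) →
      let c = ⟨ f ∣ (agent (left r) ts ≐ agent (right r) us) ∷ Δ ⟩ in
      FreshRenaming r c ρ →
      c ⟶ᵖ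
      ⟨ f ∣ toList (zipWith _≐_ ts (substᵛ (var ∘ ρ) (leftTerms r)))
         ++ toList (zipWith _≐_ us (substᵛ (var ∘ ρ) (rightTerms r)))
         ++ Δ ⟩

    -- As x occurs at most twice, the substitution replaces exactly one
    -- occurrence.
    indirection :
      ∀ {f Δ} (x : Name) (u : Term) →
      x ∉ names u → x ∈ namesᶜ ⟨ f ∣ Δ ⟩ →
      ⟨ f ∣ (var x ≐ u) ∷ Δ ⟩ ⟶ᵖ substᶜ (x ↦ u) ⟨ f ∣ Δ ⟩

  _⟶_ : Rel Configuration Level.zero
  _⟶_ = _⟶ᵖ_ on pre

  -- Reflexive transitive closure of reduction on configurations taken
  -- up to _≈_.
  _⟶*_ : Rel Configuration Level.zero
  _⟶*_ = Star (_≈_ ∪ _⟶_)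

UpwardConfluent : InteractionSystem → Set
UpwardConfluent S =
  ∀ (s₁ s₂ s : Configuration) → s₁ ⟶* s → s₂ ⟶* s →
  ∃[ s′ ] (s′ ⟶* s₁ × s′ ⟶* s₂)
  where
  open InteractionSystem S
  open Reduction S

data LinearAgent : Set where
  app lam : LinearAgent

linearSignature : Signature
linearSignature = record { Agent = LinearAgent ; arity = λ _ → 2 }

-- @[x,y] ⋈ λ[x,y], with x = 0 and y = 1.
linearRule : Terms.Rule linearSignature
linearRule = record
  { left         = app
  ; right        = lam
  ; leftTerms    = var 0 ∷ var 1 ∷ []
  ; rightTerms   = var 0 ∷ var 1 ∷ []
  ; exactlyTwice = twice
  }
  where
  open Terms linearSignature
  open import Data.List.Relation.Unary.All using (All; []; _∷_; lookup)

  xyxy : List Name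
  xyxy = 0 ∷ 1 ∷ 0 ∷ 1 ∷ []

  allTwice : All (λ x → occurrences x xyxy ≡ 2) xyxy
  allTwice = refl ∷ refl ∷ refl ∷ refl ∷ []

  twice : ∀ x → x ∈ xyxy → occurrences x xyxy ≡ 2
  twice x = lookup allTwice

linearLambda : InteractionSystem
linearLambda = record
  { signature = linearSignature
  ; RuleIndex = ⊤
  ; rule      = λ _ → linearRule
  ; atMostOne = λ _ _ _ → refl
  }

{-# OPTIONS --safe #-}

-- Any two configurations connected by a zigzag of reductions have a common
-- ancestor.  Read backwards, an indirection detaches one occurrence of a subterm
-- u: it is replaced by a fresh name x, and x = u is added.  Detaching two
-- occurrences commutes in exactly one step on each side, provided that the
-- detached terms count as part of the configuration (the occurrences may be equal
-- or nested).  An interaction is covered by a second kind of expansion, which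
-- detaches two subterms u, v under names x, y and adds @(x, y) = λ(u, v).
-- Up to α-conversion both kinds of expansion satisfy the diamond property, hence
-- "having a common expansion" is an equivalence relation; every reduction step
-- lies in it, and every expansion reduces back to what it expands.

module Submission where

open import Defs
open import Data.Empty using (⊥-elim)
open import Data.List using (List; []; _∷_; _++_; map; concatMap; filter; length)
open import Data.List.Extrema.Nat using (max; xs≤max)
open import Data.List.Membership.Propositional using (_∈_; _∉_)
open import Data.List.Membership.Propositional.Properties
  using (∈-++⁺ˡ; ∈-++⁺ʳ; ∈-++⁻; ∈-filter⁺; ∈-map⁻)
open import Data.List.Properties
  using (filter-++; length-++; filter-none; filter-accept; filter-reject; map-++)
open import Data.List.Relation.Binary.Permutation.Propositional
  using (_↭_; ↭-refl; ↭-sym; ↭-trans; prep; swap; module PermutationReasoning)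
  renaming (refl to ↭refl; trans to ↭trans)
open import Data.List.Relation.Binary.Permutation.Propositional.Properties
  using (filter-↭; ↭-length; ↭-reverse; ∈-resp-↭; ++-assoc; ++-comm; ++-identityʳ;
         ++⁺ˡ; ++⁺ʳ; shift; shifts)
open import Data.List.Relation.Unary.All as All using ([]; _∷_)
open import Data.List.Relation.Unary.AllPairs using ([]; _∷_)
open import Data.List.Relation.Unary.Any using (here; there)
open import Data.List.Relation.Unary.Unique.Propositional using (Unique)
open import Data.List.Relation.Unary.Unique.Propositional.Properties using (map⁺)
open import Data.Nat using (ℕ; zero; suc; _+_; _≤_; _≟_; s≤s)
open import Data.List.Membership.DecPropositional _≟_ using (_∈?_)
open import Data.Nat.Properties using (1+n≰n; suc-injective; ≤-reflexive; ≤-trans)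
open import Data.Product using (_×_; _,_; ∃-syntax; proj₁; proj₂)
open import Data.Sum using (_⊎_; inj₁; inj₂; [_,_])
open import Data.Unit using (tt)
open import Data.Vec using (Vec; []; _∷_)
open import Function using (_∘_; id)
open import Relation.Binary.Construct.Closure.Equivalence using (EqClosure; gmap; symmetric)
open import Relation.Binary.Construct.Closure.ReflexiveTransitive using (Star; ε; _◅_; _◅◅_)
open import Relation.Binary.Construct.Closure.Symmetric using (SymClosure; fwd; bwd)
open import Relation.Binary.PropositionalEquality
  using (_≡_; _≢_; refl; sym; trans; cong; cong₂; subst₂; module ≡-Reasoning)
  renaming (subst to transport)
open import Relation.Binary.Rewriting using (Confluent)
open import Relation.Nullary using (Dec; yes; no)

private
  variable
    x y : Name
    xs ys l l′ m : List Name

-- Fresh names, occurrence counts and exchanges of names.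

fresh : (l : List Name) → ∃[ z ] z ∉ l
fresh l = suc (max 0 l) , λ z∈l → 1+n≰n (All.lookup (xs≤max 0 l) z∈l)

fresh₂ : (l : List Name) → ∃[ p ] ∃[ q ] p ∉ l × q ∉ p ∷ l
fresh₂ l = p , q , p∉l , q∉
  where
  p = proj₁ (fresh l)
  p∉l = proj₂ (fresh l)
  q = proj₁ (fresh (p ∷ l))
  q∉ = proj₂ (fresh (p ∷ l))

∉-∷ : x ≢ y → x ∉ l → x ∉ y ∷ l
∉-∷ x≢y x∉l (here x≡y)  = x≢y x≡y
∉-∷ x≢y x∉l (there x∈l) = x∉l x∈l

∉-tail : x ∉ y ∷ l → x ∉ l
∉-tail x∉ = x∉ ∘ there

≢-head : x ∉ y ∷ l → x ≢ y
≢-head x∉ x≡y = x∉ (here x≡y)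

occurrences-++ : ∀ x l m → occurrences x (l ++ m) ≡ occurrences x l + occurrences x m
occurrences-++ x l m =
  trans (cong length (filter-++ (x ≟_) l m)) (length-++ (filter (x ≟_) l))

occurrences-↭ : ∀ x → l ↭ m → occurrences x l ≡ occurrences x m
occurrences-↭ x = ↭-length ∘ filter-↭ (x ≟_)

∉⇒occurrences≡0 : x ∉ l → occurrences x l ≡ 0
∉⇒occurrences≡0 {x} {l} x∉l =
  cong length (filter-none (x ≟_) {l} (All.tabulate λ { y∈l refl → x∉l y∈l }))

occurrences≡0⇒∉ : occurrences x l ≡ 0 → x ∉ l
occurrences≡0⇒∉ {x} {l} eq x∈l with filter (x ≟_) l | ∈-filter⁺ (x ≟_) x∈l refl
occurrences≡0⇒∉ () x∈l | _ ∷ _ | _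

occurrences-here : ∀ x l → occurrences x (x ∷ l) ≡ suc (occurrences x l)
occurrences-here x l = cong length (filter-accept (x ≟_) {x} {l} refl)

occurrences-there : ∀ {x y} l → x ≢ y → occurrences x (y ∷ l) ≡ occurrences x l
occurrences-there {x} {y} l x≢y = cong length (filter-reject (x ≟_) {y} {l} x≢y)

Unique⇒occurrences≡1 : Unique l → x ∈ l → occurrences x l ≡ 1
Unique⇒occurrences≡1 {x ∷ l} (x≢l ∷ u) (here refl) =
  trans (occurrences-here x l) (cong suc (∉⇒occurrences≡0 λ x∈l → All.lookup x≢l x∈l refl))
Unique⇒occurrences≡1 {y ∷ l} (y≢l ∷ u) (there x∈l) =
  trans (occurrences-there l (All.lookup y≢l x∈l ∘ sym)) (Unique⇒occurrences≡1 u x∈l)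

-- The involution is its own inverse, so occurrences of `x` after the renaming stem from those of
-- `ρ x` before it.
occurrences-map : (ρ : Name → Name) → (∀ y → ρ (ρ y) ≡ y) →
                  ∀ x l → occurrences x (map ρ l) ≡ occurrences (ρ x) l
occurrences-map ρ inv x []      = refl
occurrences-map ρ inv x (y ∷ l) with x ≟ ρ y
... | yes refl = begin
  occurrences x (x ∷ map ρ l)    ≡⟨ occurrences-here x (map ρ l) ⟩
  suc (occurrences x (map ρ l))  ≡⟨ cong suc (occurrences-map ρ inv x l) ⟩
  suc (occurrences (ρ x) l)      ≡⟨ occurrences-here (ρ x) l ⟨
  occurrences (ρ x) (ρ x ∷ l)    ≡⟨ cong (λ z → occurrences (ρ x) (z ∷ l)) (inv y) ⟩
  occurrences (ρ x) (y ∷ l)      ∎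
  where open ≡-Reasoning
... | no x≢ρy = begin
  occurrences x (ρ y ∷ map ρ l)  ≡⟨ occurrences-there (map ρ l) x≢ρy ⟩
  occurrences x (map ρ l)        ≡⟨ occurrences-map ρ inv x l ⟩
  occurrences (ρ x) l
    ≡⟨ occurrences-there l (λ eq → x≢ρy (trans (sym (inv x)) (cong ρ eq))) ⟨
  occurrences (ρ x) (y ∷ l)      ∎
  where open ≡-Reasoning

+≡1 : ∀ m n → m + n ≡ 1 → (m ≡ 1 × n ≡ 0) ⊎ (m ≡ 0 × n ≡ 1)
+≡1 zero          n    eq   = inj₂ (refl , eq)
+≡1 (suc zero)    zero refl = inj₁ (refl , refl)

once-++ : ∀ x l {m} → occurrences x (l ++ m) ≡ 1 →
          (occurrences x l ≡ 1 × x ∉ m) ⊎ (x ∉ l × occurrences x m ≡ 1)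
once-++ x l {m} eq with +≡1 _ _ (trans (sym (occurrences-++ x l m)) eq)
... | inj₁ (p , q) = inj₁ (p , occurrences≡0⇒∉ q)
... | inj₂ (p , q) = inj₂ (occurrences≡0⇒∉ p , q)

exchange : Name → Name → Name → Name
exchange x y z with z ≟ x | z ≟ y
... | yes _ | _     = y
... | no _  | yes _ = x
... | no _  | no _  = z

exchange-left : ∀ x y → exchange x y x ≡ y
exchange-left x y with x ≟ x
... | yes _   = refl
... | no x≢x = ⊥-elim (x≢x refl)

exchange-right : ∀ x y → exchange x y y ≡ x
exchange-right x y with y ≟ x | y ≟ y
... | yes y≡x | _       = y≡x
... | no _    | yes _   = refl
... | no _    | no y≢y = ⊥-elim (y≢y refl)

exchange-other : ∀ {x y z} → z ≢ x → z ≢ y → exchange x y z ≡ z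
exchange-other {x} {y} {z} z≢x z≢y with z ≟ x | z ≟ y
... | yes z≡x | _       = ⊥-elim (z≢x z≡x)
... | no _    | yes z≡y = ⊥-elim (z≢y z≡y)
... | no _    | no _    = refl

exchange-involutive : ∀ x y z → exchange x y (exchange x y z) ≡ z
exchange-involutive x y z with z ≟ x | z ≟ y
... | yes refl | _        = exchange-right x y
... | no _     | yes refl = exchange-left x y
... | no z≢x   | no z≢y   = exchange-other z≢x z≢y

concatMap-↭ : ∀ {A B : Set} (f : A → List B) {as bs} →
              as ↭ bs → concatMap f as ↭ concatMap f bs
concatMap-↭ f ↭refl           = ↭refl
concatMap-↭ f (prep a eq)     = ++⁺ˡ (f a) (concatMap-↭ f eq)
concatMap-↭ f (swap a b eq)   =
  ↭-trans (shifts (f a) (f b)) (++⁺ˡ (f b) (++⁺ˡ (f a) (concatMap-↭ f eq)))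
concatMap-↭ f (↭trans eq eq′) = ↭-trans (concatMap-↭ f eq) (concatMap-↭ f eq′)

Fresh : List Name → List Name → Set
Fresh xs l = Unique xs × (∀ {x} → x ∈ xs → x ∉ l)

-- Names and substitution over an arbitrary signature.

module Extraction (Sig : Signature) where
  open Terms Sig

  -- Codes for all kinds of syntax, so that names, substitution and detachment are treated once.
  -- Products and lists are included because a state will be a configuration together with the terms
  -- already detached from it.
  data Sort : Set where
    term eqn : Sort
    vec      : ℕ → Sort
    list     : Sort → Sort
    _⊗_      : Sort → Sort → Sort

  infixr 6 _⊗_

  ⟦_⟧ : Sort → Set
  ⟦ term ⟧   = Term
  ⟦ eqn ⟧    = Equation
  ⟦ vec n ⟧  = Vec Term n
  ⟦ list s ⟧ = List ⟦ s ⟧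
  ⟦ s ⊗ t ⟧  = ⟦ s ⟧ × ⟦ t ⟧

  namesˢ : ∀ s → ⟦ s ⟧ → List Name
  namesˢ term     t       = names t
  namesˢ eqn      e       = namesᵉ e
  namesˢ (vec n)  ts      = namesᵛ ts
  namesˢ (list s) as      = concatMap (namesˢ s) as
  namesˢ (s ⊗ t)  (a , b) = namesˢ s a ++ namesˢ t b

  substˢ : ∀ s → (Name → Term) → ⟦ s ⟧ → ⟦ s ⟧
  substˢ term     σ t       = subst σ t
  substˢ eqn      σ e       = substᵉ σ e
  substˢ (vec n)  σ ts      = substᵛ σ ts
  substˢ (list s) σ as      = map (substˢ s σ) as
  substˢ (s ⊗ t)  σ (a , b) = substˢ s σ a , substˢ t σ b

  substˢ-var : ∀ s a → substˢ s var a ≡ a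
  substˢ-var term     (var x)      = refl
  substˢ-var term     (agent α ts) = cong (agent α) (substˢ-var (vec _) ts)
  substˢ-var eqn      (t ≐ u)      = cong₂ _≐_ (substˢ-var term t) (substˢ-var term u)
  substˢ-var (vec _)  []           = refl
  substˢ-var (vec _)  (t ∷ ts)     = cong₂ _∷_ (substˢ-var term t) (substˢ-var (vec _) ts)
  substˢ-var (list s) []           = refl
  substˢ-var (list s) (a ∷ as)     = cong₂ _∷_ (substˢ-var s a) (substˢ-var (list s) as)
  substˢ-var (s ⊗ t)  (a , b)      = cong₂ _,_ (substˢ-var s a) (substˢ-var t b)

  -- The equation is demanded only for names that occur in `a`; with `var` as the inner substitution
  -- this yields `substˢ-cong`.
  substˢ-substˢ : ∀ {σ τ υ} s a →
                  (∀ {y} → y ∈ namesˢ s a → subst σ (τ y) ≡ υ y) →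
                  substˢ s σ (substˢ s τ a) ≡ substˢ s υ a
  substˢ-substˢ term (var x) eq = eq (here refl)
  substˢ-substˢ term (agent α ts) eq = cong (agent α) (substˢ-substˢ (vec _) ts eq)
  substˢ-substˢ eqn (t ≐ u) eq = cong₂ _≐_
    (substˢ-substˢ term t (eq ∘ ∈-++⁺ˡ)) (substˢ-substˢ term u (eq ∘ ∈-++⁺ʳ (names t)))
  substˢ-substˢ (vec _) [] eq = refl
  substˢ-substˢ (vec _) (t ∷ ts) eq = cong₂ _∷_
    (substˢ-substˢ term t (eq ∘ ∈-++⁺ˡ)) (substˢ-substˢ (vec _) ts (eq ∘ ∈-++⁺ʳ (names t)))
  substˢ-substˢ (list s) [] eq = refl
  substˢ-substˢ (list s) (a ∷ as) eq = cong₂ _∷_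
    (substˢ-substˢ s a (eq ∘ ∈-++⁺ˡ)) (substˢ-substˢ (list s) as (eq ∘ ∈-++⁺ʳ (namesˢ s a)))
  substˢ-substˢ (s ⊗ t) (a , b) eq = cong₂ _,_
    (substˢ-substˢ s a (eq ∘ ∈-++⁺ˡ)) (substˢ-substˢ t b (eq ∘ ∈-++⁺ʳ (namesˢ s a)))

  substˢ-cong : ∀ {σ τ} s a → (∀ {y} → y ∈ namesˢ s a → σ y ≡ τ y) →
                substˢ s σ a ≡ substˢ s τ a
  substˢ-cong {σ} s a eq =
    trans (cong (substˢ s σ) (sym (substˢ-var s a))) (substˢ-substˢ s a eq)

  substˢ-id : ∀ {σ} s a → (∀ {y} → y ∈ namesˢ s a → σ y ≡ var y) → substˢ s σ a ≡ a
  substˢ-id s a eq = trans (substˢ-cong s a eq) (substˢ-var s a)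

  ↦-self : ∀ x u → (x ↦ u) x ≡ u
  ↦-self x u with x ≟ x
  ... | yes _   = refl
  ... | no x≢x = ⊥-elim (x≢x refl)

  ↦-other : ∀ {x u y} → x ≢ y → (x ↦ u) y ≡ var y
  ↦-other {x} {u} {y} x≢y with x ≟ y
  ... | yes x≡y = ⊥-elim (x≢y x≡y)
  ... | no _    = refl

  substˢ-∉ : ∀ {u} s a → x ∉ namesˢ s a → substˢ s (x ↦ u) a ≡ a
  substˢ-∉ {u = u} s a x∉a = substˢ-id s a λ y∈a → ↦-other {u = u} λ { refl → x∉a y∈a }

  namesˢ-rename : ∀ ρ s a → namesˢ s (substˢ s (var ∘ ρ) a) ≡ map ρ (namesˢ s a)
  namesˢ-rename ρ term (var x) = refl
  namesˢ-rename ρ term (agent α ts) = namesˢ-rename ρ (vec _) ts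
  namesˢ-rename ρ eqn (t ≐ u) =
    trans (cong₂ _++_ (namesˢ-rename ρ term t) (namesˢ-rename ρ term u))
          (sym (map-++ ρ (names t) (names u)))
  namesˢ-rename ρ (vec _) [] = refl
  namesˢ-rename ρ (vec _) (t ∷ ts) =
    trans (cong₂ _++_ (namesˢ-rename ρ term t) (namesˢ-rename ρ (vec _) ts))
          (sym (map-++ ρ (names t) (namesᵛ ts)))
  namesˢ-rename ρ (list s) [] = refl
  namesˢ-rename ρ (list s) (a ∷ as) =
    trans (cong₂ _++_ (namesˢ-rename ρ s a) (namesˢ-rename ρ (list s) as))
          (sym (map-++ ρ (namesˢ s a) (namesˢ (list s) as)))
  namesˢ-rename ρ (s ⊗ t) (a , b) =
    trans (cong₂ _++_ (namesˢ-rename ρ s a) (namesˢ-rename ρ t b))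
          (sym (map-++ ρ (namesˢ s a) (namesˢ t b)))

  -- Detaching one occurrence of a subterm.

  -- Detach x u s a a′: replacing one occurrence of the subterm u in a by the name x
  -- yields a′.
  data Detach (x : Name) (u : Term) : ∀ s → ⟦ s ⟧ → ⟦ s ⟧ → Set where
    here  : Detach x u term u (var x)
    arg   : ∀ {α ts ts′} → Detach x u (vec (arity α)) ts ts′ →
            Detach x u term (agent α ts) (agent α ts′)
    lhs   : ∀ {t t′ v} → Detach x u term t t′ → Detach x u eqn (t ≐ v) (t′ ≐ v)
    rhs   : ∀ {t v v′} → Detach x u term v v′ → Detach x u eqn (t ≐ v) (t ≐ v′)
    headᵛ : ∀ {n t t′} {ts : Vec Term n} → Detach x u term t t′ →
            Detach x u (vec (suc n)) (t ∷ ts) (t′ ∷ ts)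
    tailᵛ : ∀ {n t} {ts ts′ : Vec Term n} → Detach x u (vec n) ts ts′ →
            Detach x u (vec (suc n)) (t ∷ ts) (t ∷ ts′)
    head  : ∀ {s a a′ as} → Detach x u s a a′ → Detach x u (list s) (a ∷ as) (a′ ∷ as)
    tail  : ∀ {s a as as′} → Detach x u (list s) as as′ → Detach x u (list s) (a ∷ as) (a ∷ as′)
    fst   : ∀ {s t a a′ b} → Detach x u s a a′ → Detach x u (s ⊗ t) (a , b) (a′ , b)
    snd   : ∀ {s t a b b′} → Detach x u t b b′ → Detach x u (s ⊗ t) (a , b) (a , b′)

  -- The multiset equation `l′ = l - m + x`, expressed by a common rest `r` in place of a
  -- difference.
  Replaces : Name → List Name → List Name → List Name → Set
  Replaces x m l l′ = ∃[ r ] l ↭ m ++ r × l′ ↭ x ∷ r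

  replaces-++ˡ : ∀ k → Replaces x m l l′ → Replaces x m (l ++ k) (l′ ++ k)
  replaces-++ˡ {m = m} k (r , p , q) =
    r ++ k , ↭-trans (++⁺ʳ k p) (++-assoc m r k) , ++⁺ʳ k q

  replaces-++ʳ : ∀ k → Replaces x m l l′ → Replaces x m (k ++ l) (k ++ l′)
  replaces-++ʳ {x = x} {m = m} k (r , p , q) =
    k ++ r , ↭-trans (++⁺ˡ k p) (shifts k m) , ↭-trans (++⁺ˡ k q) (shift x k r)

  detach-names : ∀ {x u s a a′} → Detach x u s a a′ →
                 Replaces x (names u) (namesˢ s a) (namesˢ s a′)
  detach-names {u = u} here = [] , ↭-sym (++-identityʳ (names u)) , ↭-refl
  detach-names (arg p)                      = detach-names p
  detach-names (lhs {v = v} p)              = replaces-++ˡ (names v) (detach-names p)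
  detach-names (rhs {t = t} p)              = replaces-++ʳ (names t) (detach-names p)
  detach-names (headᵛ {ts = ts} p)          = replaces-++ˡ (namesᵛ ts) (detach-names p)
  detach-names (tailᵛ {t = t} p)            = replaces-++ʳ (names t) (detach-names p)
  detach-names (head {s = s} {as = as} p)   = replaces-++ˡ (namesˢ (list s) as) (detach-names p)
  detach-names (tail {s = s} {a = a} p)     = replaces-++ʳ (namesˢ s a) (detach-names p)
  detach-names (fst {t = t} {b = b} p)      = replaces-++ˡ (namesˢ t b) (detach-names p)
  detach-names (snd {s = s} {a = a} p)      = replaces-++ʳ (namesˢ s a) (detach-names p)

  detach-subst : ∀ {x u s a a′ σ y} → σ x ≡ var y → Detach x u s a a′ →
                 Detach y (subst σ u) s (substˢ s σ a) (substˢ s σ a′)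
  detach-subst eq here rewrite eq = here
  detach-subst eq (arg p)   = arg (detach-subst eq p)
  detach-subst eq (lhs p)   = lhs (detach-subst eq p)
  detach-subst eq (rhs p)   = rhs (detach-subst eq p)
  detach-subst eq (headᵛ p) = headᵛ (detach-subst eq p)
  detach-subst eq (tailᵛ p) = tailᵛ (detach-subst eq p)
  detach-subst eq (head p)  = head (detach-subst eq p)
  detach-subst eq (tail p)  = tail (detach-subst eq p)
  detach-subst eq (fst p)   = fst (detach-subst eq p)
  detach-subst eq (snd p)   = snd (detach-subst eq p)

  -- As `x` is absent from `a`, the hole is the only `x` in `a′`, and filling it undoes the
  -- detachment. This makes indirection the inverse of detaching.
  detach-restore : ∀ {x u s a a′} → x ∉ namesˢ s a → Detach x u s a a′ →
                   substˢ s (x ↦ u) a′ ≡ a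
  detach-restore {x} {u} x∉ here = ↦-self x u
  detach-restore x∉ (arg p) = cong (agent _) (detach-restore x∉ p)
  detach-restore x∉ (lhs {t} {v = v} p) = cong₂ _≐_
    (detach-restore (x∉ ∘ ∈-++⁺ˡ) p) (substˢ-∉ term v (x∉ ∘ ∈-++⁺ʳ (names t)))
  detach-restore x∉ (rhs {t} p) = cong₂ _≐_
    (substˢ-∉ term t (x∉ ∘ ∈-++⁺ˡ)) (detach-restore (x∉ ∘ ∈-++⁺ʳ (names t)) p)
  detach-restore x∉ (headᵛ {t = t} {ts = ts} p) = cong₂ _∷_
    (detach-restore (x∉ ∘ ∈-++⁺ˡ) p) (substˢ-∉ (vec _) ts (x∉ ∘ ∈-++⁺ʳ (names t)))
  detach-restore x∉ (tailᵛ {t = t} p) = cong₂ _∷_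
    (substˢ-∉ term t (x∉ ∘ ∈-++⁺ˡ)) (detach-restore (x∉ ∘ ∈-++⁺ʳ (names t)) p)
  detach-restore x∉ (head {s} {a} {as = as} p) = cong₂ _∷_
    (detach-restore (x∉ ∘ ∈-++⁺ˡ) p) (substˢ-∉ (list s) as (x∉ ∘ ∈-++⁺ʳ (namesˢ s a)))
  detach-restore x∉ (tail {s} {a} p) = cong₂ _∷_
    (substˢ-∉ s a (x∉ ∘ ∈-++⁺ˡ)) (detach-restore (x∉ ∘ ∈-++⁺ʳ (namesˢ s a)) p)
  detach-restore x∉ (fst {s} {t} {a} {b = b} p) = cong₂ _,_
    (detach-restore (x∉ ∘ ∈-++⁺ˡ) p) (substˢ-∉ t b (x∉ ∘ ∈-++⁺ʳ (namesˢ s a)))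
  detach-restore x∉ (snd {s} {a = a} p) = cong₂ _,_
    (substˢ-∉ s a (x∉ ∘ ∈-++⁺ˡ)) (detach-restore (x∉ ∘ ∈-++⁺ʳ (namesˢ s a)) p)

  -- The backward reading of an indirection. The single occurrence lies in exactly one component,
  -- and the substitution leaves the siblings alone; descending along it traces the detachment.
  detach-of-once : ∀ {x u} s a → occurrences x (namesˢ s a) ≡ 1 →
                   Detach x u s (substˢ s (x ↦ u) a) a
  detach-of-once {x} term (var y) eq with x ≟ y
  ... | yes refl = here
  ... | no x≢y with trans (sym (occurrences-there [] x≢y)) eq
  ...   | ()
  detach-of-once term (agent α ts) eq = arg (detach-of-once (vec _) ts eq)
  detach-of-once {x} {u} eqn (t ≐ v) eq with once-++ x (names t) eq
  ... | inj₁ (p , q) rewrite substˢ-∉ {x} {u} term v q = lhs (detach-of-once term t p)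
  ... | inj₂ (p , q) rewrite substˢ-∉ {x} {u} term t p = rhs (detach-of-once term v q)
  detach-of-once {x} {u} (vec _) (t ∷ ts) eq with once-++ x (names t) eq
  ... | inj₁ (p , q) rewrite substˢ-∉ {x} {u} (vec _) ts q = headᵛ (detach-of-once term t p)
  ... | inj₂ (p , q) rewrite substˢ-∉ {x} {u} term t p = tailᵛ (detach-of-once (vec _) ts q)
  detach-of-once {x} {u} (list s) (a ∷ as) eq with once-++ x (namesˢ s a) eq
  ... | inj₁ (p , q) rewrite substˢ-∉ {x} {u} (list s) as q = head (detach-of-once s a p)
  ... | inj₂ (p , q) rewrite substˢ-∉ {x} {u} s a p = tail (detach-of-once (list s) as q)
  detach-of-once {x} {u} (s ⊗ t) (a , b) eq with once-++ x (namesˢ s a) eq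
  ... | inj₁ (p , q) rewrite substˢ-∉ {x} {u} t b q = fst (detach-of-once s a p)
  ... | inj₂ (p , q) rewrite substˢ-∉ {x} {u} s a p = snd (detach-of-once t b q)

  -- Commutation of two detachments.

  -- A detached term stays part of the state, so that an occurrence nested in it
  -- remains accessible; this makes the diamond for two detachments strict.
  record Join (x y : Name) (u v : Term) {s} (a₁ a₂ : ⟦ s ⟧) : Set where
    constructor join
    field
      {u′ v′} : Term
      {b}     : ⟦ s ⟧
      left    : Detach y v′ (term ⊗ s) (u , a₁) (u′ , b)
      right   : Detach x u′ (term ⊗ s) (v , a₂) (v′ , b)

  lift : ∀ {x u s s′ v v′ a a′} (f : ⟦ s ⟧ → ⟦ s′ ⟧) →
         (∀ {b b′} → Detach x u s b b′ → Detach x u s′ (f b) (f b′)) →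
         Detach x u (term ⊗ s) (v , a) (v′ , a′) → Detach x u (term ⊗ s′) (v , f a) (v′ , f a′)
  lift f f⁺ (fst p) = fst p
  lift f f⁺ (snd p) = snd (f⁺ p)

  lift-join : ∀ {x y u v s s′} {a₁ a₂ : ⟦ s ⟧} (f : ⟦ s ⟧ → ⟦ s′ ⟧) →
              (∀ {z t b b′} → Detach z t s b b′ → Detach z t s′ (f b) (f b′)) →
              Join x y u v {s} a₁ a₂ → Join x y u v {s′} (f a₁) (f a₂)
  lift-join f f⁺ (join l r) = join (lift f f⁺ l) (lift f f⁺ r)

  -- Disjoint occurrences do not interact. If one lies inside the other, the inner one is detached
  -- from the already detached outer term. If they coincide, the term ends up detached under `y`,
  -- and `var y` under `x`.
  detach-join : ∀ {x y u v s a a₁ a₂} → Detach x u s a a₁ → Detach y v s a a₂ →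
                Join x y u v {s} a₁ a₂
  detach-join here      here      = join (fst here) (snd here)
  detach-join here      (arg q)   = join (fst (arg q)) (snd here)
  detach-join (arg p)   here      = join (snd here) (fst (arg p))
  detach-join (arg p)   (arg q)   = lift-join (agent _) arg (detach-join p q)
  detach-join (lhs p)   (lhs q)   = lift-join (_≐ _) lhs (detach-join p q)
  detach-join (lhs p)   (rhs q)   = join (snd (rhs q)) (snd (lhs p))
  detach-join (rhs p)   (lhs q)   = join (snd (lhs q)) (snd (rhs p))
  detach-join (rhs p)   (rhs q)   = lift-join (_ ≐_) rhs (detach-join p q)
  detach-join (headᵛ p) (headᵛ q) = lift-join (_∷ _) headᵛ (detach-join p q)
  detach-join (headᵛ p) (tailᵛ q) = join (snd (tailᵛ q)) (snd (headᵛ p))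
  detach-join (tailᵛ p) (headᵛ q) = join (snd (headᵛ q)) (snd (tailᵛ p))
  detach-join (tailᵛ p) (tailᵛ q) = lift-join (_ ∷_) tailᵛ (detach-join p q)
  detach-join (head p)  (head q)  = lift-join (_∷ _) head (detach-join p q)
  detach-join (head p)  (tail q)  = join (snd (tail q)) (snd (head p))
  detach-join (tail p)  (head q)  = join (snd (head q)) (snd (tail p))
  detach-join (tail p)  (tail q)  = lift-join (_ ∷_) tail (detach-join p q)
  detach-join (fst p)   (fst q)   = lift-join (_, _) fst (detach-join p q)
  detach-join (fst p)   (snd q)   = join (snd (snd q)) (snd (fst p))
  detach-join (snd p)   (fst q)   = join (snd (fst q)) (snd (snd p))
  detach-join (snd p)   (snd q)   = lift-join (_ ,_) snd (detach-join p q)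

  -- Sequences of detachments.

  -- The list of terms holds those detached so far, the latest first; later
  -- detachments may act on them as well.
  data Detachments (s : Sort) : List Name → ⟦ list term ⊗ s ⟧ → ⟦ list term ⊗ s ⟧ → Set where
    []  : ∀ {c} → Detachments s [] c c
    _∷_ : ∀ {x xs u c o o′ a a′} → Detach x u (list term ⊗ s) (o , a) (o′ , a′) →
          Detachments s xs c (o , a) → Detachments s (x ∷ xs) c (u ∷ o′ , a′)

  detach-exchange : ∀ {x u r s t a a′ b b′ c c′} →
                    Detach x u (r ⊗ s ⊗ t) (a , b , c) (a′ , b′ , c′) →
                    Detach x u (s ⊗ r ⊗ t) (b , a , c) (b′ , a′ , c′)
  detach-exchange (fst p)       = snd (fst p)
  detach-exchange (snd (fst p)) = fst p
  detach-exchange (snd (snd p)) = snd (snd p)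

  detach-cons : ∀ {x u s v v′ o o′ a a′} →
                Detach x u (term ⊗ list term ⊗ s) (v , o , a) (v′ , o′ , a′) →
                Detach x u (list term ⊗ s) (v ∷ o , a) (v′ ∷ o′ , a′)
  detach-cons (fst p)       = fst (head p)
  detach-cons (snd (fst p)) = fst (tail p)
  detach-cons (snd (snd p)) = snd p

  detachments-cons : ∀ {s xs v v′ q q′ o o′ a a′} →
                     Detachments (term ⊗ list term ⊗ s) xs (q , v , o , a) (q′ , v′ , o′ , a′) →
                     Detachments (list term ⊗ s) xs (q , v ∷ o , a) (q′ , v′ ∷ o′ , a′)
  detachments-cons []           = []
  detachments-cons (fst p ∷ ps) = fst p ∷ detachments-cons ps
  detachments-cons (snd p ∷ ps) = snd (detach-cons p) ∷ detachments-cons ps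

  detachments-snd : ∀ {s t xs o o′ b a a′} → Detachments s xs (o , a) (o′ , a′) →
                    Detachments (t ⊗ s) xs (o , b , a) (o′ , b , a′)
  detachments-snd []           = []
  detachments-snd (fst p ∷ ps) = fst p ∷ detachments-snd ps
  detachments-snd (snd p ∷ ps) = snd (snd p) ∷ detachments-snd ps

  -- The term `u` travels along as an extra component of the state, since the detachments of `ys`
  -- may cut into it and turn it into `u′`.
  strip : ∀ {s x u ys o o₁ o₂ a a₁ a₂} →
          Detach x u (list term ⊗ s) (o , a) (o₁ , a₁) →
          Detachments s ys (o , a) (o₂ , a₂) →
          ∃[ u′ ] ∃[ o₃ ] ∃[ a₃ ]
            Detachments (term ⊗ s) ys (o₁ , u , a₁) (o₃ , u′ , a₃) ×
            Detach x u′ (list term ⊗ s) (o₂ , a₂) (o₃ , a₃)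
  strip p []       = _ , _ , _ , [] , p
  strip p (q ∷ qs) with strip p qs
  ... | _ , _ , _ , qs′ , p′ with detach-join p′ q
  ...   | join q′ p″ = _ , _ , _ , detach-exchange q′ ∷ qs′ , detach-cons p″

  -- Each sequence has its own list of detached terms and treats the list of the other as part of
  -- the configuration; hence the state is read as `(o , p , a)` by one and as `(p , o , a)` by the
  -- other.
  grid : ∀ {s xs ys o o₁ o₂ p p₁ p₂ a a₁ a₂} →
         Detachments (list term ⊗ s) xs (o , p , a) (o₁ , p₁ , a₁) →
         Detachments (list term ⊗ s) ys (p , o , a) (p₂ , o₂ , a₂) →
         ∃[ o₃ ] ∃[ p₃ ] ∃[ a₃ ]
           Detachments (list term ⊗ s) ys (p₁ , o₁ , a₁) (p₃ , o₃ , a₃) ×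
           Detachments (list term ⊗ s) xs (o₂ , p₂ , a₂) (o₃ , p₃ , a₃)
  grid []       qs = _ , _ , _ , qs , []
  grid (p ∷ ps) qs with grid ps qs
  ... | _ , _ , _ , qs′ , ps′ with strip (detach-exchange p) qs′
  ...   | _ , _ , _ , qs″ , p′ = _ , _ , _ , detachments-cons qs″ , detach-exchange p′ ∷ ps′

  -- Detached terms still count in the state, so a detachment loses no name and adds only its own
  -- name at the hole.
  detachments-names : ∀ {s xs c c′} → Detachments s xs c c′ →
                      namesˢ (list term ⊗ s) c′ ↭ xs ++ namesˢ (list term ⊗ s) c
  detachments-names [] = ↭-refl
  detachments-names {s} (_∷_ {x} {xs} {u} {c} {o} {o′} {a} {a′} p ps) with detach-names p
  ... | r , eq , eq′ = begin
    (names u ++ concatMap names o′) ++ namesˢ s a′      ↭⟨ ++-assoc (names u) _ _ ⟩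
    names u ++ namesˢ (list term ⊗ s) (o′ , a′)         ↭⟨ ++⁺ˡ (names u) eq′ ⟩
    names u ++ x ∷ r                                    ↭⟨ shift x (names u) r ⟩
    x ∷ names u ++ r                                    ↭⟨ prep x eq ⟨
    x ∷ namesˢ (list term ⊗ s) (o , a)                  ↭⟨ prep x (detachments-names ps) ⟩
    x ∷ xs ++ namesˢ (list term ⊗ s) c                  ∎
    where open PermutationReasoning

  detachments-rename : ∀ {s xs c c′} ρ → Detachments s xs c c′ →
                       Detachments s (map ρ xs) (substˢ (list term ⊗ s) (var ∘ ρ) c)
                                           (substˢ (list term ⊗ s) (var ∘ ρ) c′)
  detachments-rename ρ []       = []
  detachments-rename ρ (p ∷ ps) = detach-subst refl p ∷ detachments-rename ρ ps

  -- Identification of configurations, and linearity.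

  config : Sort
  config = list term ⊗ list eqn

  data Rearranged : ⟦ config ⟧ → ⟦ config ⟧ → Set where
    permute : ∀ {f Δ Ξ} → Δ ↭ Ξ → Rearranged (f , Δ) (f , Ξ)
    flip    : ∀ {f t u Δ} → Rearranged (f , (t ≐ u) ∷ Δ) (f , (u ≐ t) ∷ Δ)

  detach-↭ : ∀ {x u s Δ Δ′ Ξ} → Δ ↭ Ξ → Detach x u (list s) Δ Δ′ →
             ∃[ Ξ′ ] Δ′ ↭ Ξ′ × Detach x u (list s) Ξ Ξ′
  detach-↭ ↭refl        p               = _ , ↭refl , p
  detach-↭ (prep _ eq)   (head p)        = _ , prep _ eq , head p
  detach-↭ (prep _ eq)   (tail p) with detach-↭ eq p
  ... | _ , eq′ , p′ = _ , prep _ eq′ , tail p′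
  detach-↭ (swap _ _ eq) (head p)        = _ , swap _ _ eq , tail (head p)
  detach-↭ (swap _ _ eq) (tail (head p)) = _ , swap _ _ eq , head p
  detach-↭ (swap _ _ eq) (tail (tail p)) with detach-↭ eq p
  ... | _ , eq′ , p′ = _ , swap _ _ eq′ , tail (tail p′)
  detach-↭ (↭trans eq₁ eq₂) p with detach-↭ eq₁ p
  ... | _ , eq₁′ , p′ with detach-↭ eq₂ p′
  ...   | _ , eq₂′ , p″ = _ , ↭trans eq₁′ eq₂′ , p″

  detach-rearrange : ∀ {x u c c′ d} → Rearranged c d → Detach x u config c c′ →
                     ∃[ d′ ] Rearranged c′ d′ × Detach x u config d d′
  detach-rearrange (permute eq) (fst p) = _ , permute eq , fst p
  detach-rearrange (permute eq) (snd p) with detach-↭ eq p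
  ... | _ , eq′ , p′ = _ , permute eq′ , snd p′
  detach-rearrange flip (fst p)              = _ , flip , fst p
  detach-rearrange flip (snd (head (lhs p))) = _ , flip , snd (head (rhs p))
  detach-rearrange flip (snd (head (rhs p))) = _ , flip , snd (head (lhs p))
  detach-rearrange flip (snd (tail p))       = _ , flip , snd (tail p)

  detachments-rearrange : ∀ {xs o o′ c c′ d} → Rearranged c d → Detachments config xs (o , c) (o′ , c′) →
                          ∃[ d′ ] Rearranged c′ d′ × Detachments config xs (o , d) (o′ , d′)
  detachments-rearrange eq [] = _ , eq , []
  detachments-rearrange eq (fst p ∷ ps) with detachments-rearrange eq ps
  ... | _ , eq′ , ps′ = _ , eq′ , fst p ∷ ps′
  detachments-rearrange eq (snd p ∷ ps) with detachments-rearrange eq ps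
  ... | _ , eq′ , ps′ with detach-rearrange eq′ p
  ...   | _ , eq″ , p′ = _ , eq″ , snd p′ ∷ ps′

  infix 4 _≋_

  -- Identification without linearity proofs. Each step preserves linearity, so `≋⇒≈` can supply the
  -- proofs for the intermediate configurations.
  _≋_ : PreConfiguration → PreConfiguration → Set
  _≋_ = EqClosure _≈ᵖ_

  ≋-sym : ∀ {c d} → c ≋ d → d ≋ c
  ≋-sym = symmetric _≈ᵖ_

  Linear : PreConfiguration → Set
  Linear c = ∀ x → occurrences x (namesᶜ c) ≤ 2

  parts : PreConfiguration → ⟦ config ⟧
  parts ⟨ f ∣ Δ ⟩ = f , Δ

  assemble : ⟦ config ⟧ → PreConfiguration
  assemble (f , Δ) = ⟨ f ∣ Δ ⟩

  exchangeᶜ : Name → Name → PreConfiguration → PreConfiguration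
  exchangeᶜ x y = substᶜ (var ∘ exchange x y)

  substᶜ-cong : ∀ {σ τ} c → (∀ {z} → z ∈ namesᶜ c → σ z ≡ τ z) → substᶜ σ c ≡ substᶜ τ c
  substᶜ-cong c eq = cong assemble (substˢ-cong config (parts c) eq)

  exchangeᶜ-involutive : ∀ x y c → exchangeᶜ x y (exchangeᶜ x y c) ≡ c
  exchangeᶜ-involutive x y c = cong assemble (trans
    (substˢ-substˢ {υ = var} config (parts c) λ {z} _ → cong var (exchange-involutive x y z))
    (substˢ-var config (parts c)))

  exchangeᶜ-fresh : ∀ {x y} c → x ∉ namesᶜ c → y ∉ namesᶜ c → exchangeᶜ x y c ≡ c
  exchangeᶜ-fresh c x∉c y∉c = cong assemble (substˢ-id config (parts c) λ z∈c →
    cong var (exchange-other (λ { refl → x∉c z∈c }) (λ { refl → y∉c z∈c })))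

  occurrences-exchangeᶜ : ∀ x y z c → occurrences z (namesᶜ (exchangeᶜ x y c)) ≡
                                      occurrences (exchange x y z) (namesᶜ c)
  occurrences-exchangeᶜ x y z c = trans
    (cong (occurrences z) (namesˢ-rename (exchange x y) config (parts c)))
    (occurrences-map (exchange x y) (exchange-involutive x y) z (namesᶜ c))

  ↦-exchange : ∀ {x y z} → z ≢ y → (x ↦ var y) z ≡ var (exchange x y z)
  ↦-exchange {x} {y} {z} z≢y with x ≟ z
  ... | yes refl = cong var (sym (exchange-left x y))
  ... | no x≢z   = cong var (sym (exchange-other (x≢z ∘ sym) z≢y))

  ↦-exchange′ : ∀ {x y z} → z ≢ x → (y ↦ var x) z ≡ var (exchange x y z)
  ↦-exchange′ {x} {y} {z} z≢x with y ≟ z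
  ... | yes refl = cong var (sym (exchange-right x y))
  ... | no y≢z   = cong var (sym (exchange-other z≢x (y≢z ∘ sym)))

  BoundFresh : Name → Name → PreConfiguration → Set
  BoundFresh x y c = occurrences x (namesᶜ c) ≡ 2 × y ∉ namesᶜ c

  -- Writing α-conversion as an exchange of two names makes it an involution.
  data Step : PreConfiguration → PreConfiguration → Set where
    rearranged : ∀ {c d} → Rearranged (parts c) (parts d) → Step c d
    exchanged  : ∀ {c x y} → BoundFresh x y c ⊎ BoundFresh y x c → Step c (exchangeᶜ x y c)

  step-≋ : ∀ {c d} → Step c d → c ≋ d
  step-≋ (rearranged (permute eq)) = fwd (permute eq) ◅ ε
  step-≋ (rearranged flip)         = fwd flip ◅ ε
  step-≋ (exchanged {c} {x} {y} (inj₁ (twice , y∉c))) = fwd (transport (c ≈ᵖ_)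
    (substᶜ-cong c λ z∈c → ↦-exchange λ { refl → y∉c z∈c }) (alpha twice y∉c)) ◅ ε
  step-≋ (exchanged {c} {x} {y} (inj₂ (twice , x∉c))) = fwd (transport (c ≈ᵖ_)
    (substᶜ-cong c λ z∈c → ↦-exchange′ λ { refl → x∉c z∈c }) (alpha twice x∉c)) ◅ ε

  ≈ᵖ-step : ∀ {c d} → SymClosure _≈ᵖ_ c d → Step c d
  ≈ᵖ-step (fwd (permute eq)) = rearranged (permute eq)
  ≈ᵖ-step (fwd flip)         = rearranged flip
  ≈ᵖ-step (fwd (alpha {c} {x} {y} twice y∉c)) = transport (Step c)
    (sym (substᶜ-cong c λ z∈c → ↦-exchange λ { refl → y∉c z∈c }))
    (exchanged (inj₁ (twice , y∉c)))
  ≈ᵖ-step (bwd (permute eq)) = rearranged (permute (↭-sym eq))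
  ≈ᵖ-step (bwd flip)         = rearranged flip
  -- Backwards, the same exchange is applied once more: in the renamed configuration `y` occurs
  -- twice and `x` is fresh, the second alternative of `exchanged`.
  ≈ᵖ-step (bwd (alpha {c} {x} {y} twice y∉c)) = subst₂ Step
    (sym (substᶜ-cong c λ z∈c → ↦-exchange λ { refl → y∉c z∈c }))
    (exchangeᶜ-involutive x y c)
    (exchanged (inj₂
      ( trans (occurrences-exchangeᶜ x y y c)
          (trans (cong (λ z → occurrences z (namesᶜ c)) (exchange-right x y)) twice)
      , occurrences≡0⇒∉ (trans (occurrences-exchangeᶜ x y x c)
          (trans (cong (λ z → occurrences z (namesᶜ c)) (exchange-left x y))
            (∉⇒occurrences≡0 y∉c))))))

  rearranged-names : ∀ {c d} → Rearranged c d → namesˢ config c ↭ namesˢ config d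
  rearranged-names {f , Δ} (permute eq) =
    ++⁺ˡ (concatMap names f) (concatMap-↭ namesᵉ eq)
  rearranged-names {f , (t ≐ u) ∷ Δ} flip =
    ++⁺ˡ (concatMap names f) (++⁺ʳ (concatMap namesᵉ Δ) (++-comm (names t) (names u)))

  step-linear : ∀ {c d} → Step c d → Linear c → Linear d
  step-linear (rearranged eq) lin x =
    ≤-trans (≤-reflexive (occurrences-↭ x (↭-sym (rearranged-names eq)))) (lin x)
  step-linear (exchanged {c} {x} {y} _) lin z =
    ≤-trans (≤-reflexive (occurrences-exchangeᶜ x y z c)) (lin (exchange x y z))

  ≋-linear : ∀ {c d} → c ≋ d → Linear c → Linear d
  ≋-linear ε        lin = lin
  ≋-linear (s ◅ ss) lin = ≋-linear ss (step-linear (≈ᵖ-step s) lin)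

  ≋⇒≈ : ∀ {c d} → c ≋ d → (c-lin : Linear c) (d-lin : Linear d) →
        record { pre = c ; atMostTwice = c-lin } ≈ record { pre = d ; atMostTwice = d-lin }
  -- The two sides may carry different linearity proofs, so a trivial permutation is used in place
  -- of reflexivity.
  ≋⇒≈ ε             c-lin d-lin = fwd (permute ↭refl) ◅ ε
  ≋⇒≈ (fwd s ◅ ss) c-lin d-lin =
    fwd s ◅ ≋⇒≈ ss (step-linear (≈ᵖ-step (fwd s)) c-lin) d-lin
  ≋⇒≈ (bwd s ◅ ss) c-lin d-lin =
    bwd s ◅ ≋⇒≈ ss (step-linear (≈ᵖ-step (bwd s)) c-lin) d-lin

  ≋-permute : ∀ {f Δ Ξ} → Δ ↭ Ξ → ⟨ f ∣ Δ ⟩ ≋ ⟨ f ∣ Ξ ⟩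
  ≋-permute eq = fwd (permute eq) ◅ ε

  ≋-flip : ∀ {f t u Δ} Γ → ⟨ f ∣ Γ ++ (t ≐ u) ∷ Δ ⟩ ≋ ⟨ f ∣ Γ ++ (u ≐ t) ∷ Δ ⟩
  ≋-flip Γ = ≋-permute (shift _ Γ _) ◅◅ (fwd flip ◅ ε) ◅◅ ≋-permute (↭-sym (shift _ Γ _))

-- Expansions for the linear λ-calculus.

open InteractionSystem linearLambda
open Reduction linearLambda
open Extraction linearSignature

private
  variable
    u v : Term
    f : List Term
    Δ : List Equation
    c d G G₁ G₂ H : PreConfiguration

infix 6 _＠_ _ƛ_

pattern _＠_ t u = agent app (t ∷ u ∷ [])
pattern _ƛ_ t u  = agent lam (t ∷ u ∷ [])

-- What is added to a configuration for terms detached under given names: either a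
-- plain equation, or the ports of an active pair that interacts back to the
-- equations x = u and y = v.
data Block : List Name → List Term → Equation → Set where
  wire  : Block (x ∷ []) (u ∷ []) (var x ≐ u)
  redex : Block (y ∷ x ∷ []) (v ∷ u ∷ []) (var x ＠ var y ≐ u ƛ v)

data Expansion (xs : List Name) : PreConfiguration → PreConfiguration → Set where
  expand : ∀ {os e f f′ Δ Δ′} → Detachments config xs ([] , f , Δ) (os , f′ , Δ′) →
           Block xs os e → Fresh xs (namesᶜ ⟨ f ∣ Δ ⟩) →
           Expansion xs ⟨ f ∣ Δ ⟩ ⟨ f′ ∣ e ∷ Δ′ ⟩

-- A block holds each new name once and all the detached terms, so nothing that was cut off is lost.
block-names : ∀ {os e} → Block xs os e → namesᵉ e ↭ xs ++ concatMap names os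
block-names (wire {x} {u}) = prep x (↭-sym (++-identityʳ (names u)))
block-names (redex {y} {x} {v} {u}) = swap x y (shifts (names u) (names v))

-- Each new name appears once at its hole and once in the block, and the names of the detached terms
-- merely move into the block. Preservation of linearity and the membership facts for expansions
-- rest on this count.
expansion-names : Expansion xs c G → namesᶜ G ↭ xs ++ xs ++ namesᶜ c
expansion-names {xs} (expand {os} {e} {f} {f′} {Δ} {Δ′} ps b _) = begin
  F ++ namesᵉ e ++ D             ↭⟨ shifts F (namesᵉ e) ⟩
  namesᵉ e ++ F ++ D             ↭⟨ ++⁺ʳ (F ++ D) (block-names b) ⟩
  (xs ++ O) ++ F ++ D            ↭⟨ ++-assoc xs O (F ++ D) ⟩
  xs ++ O ++ F ++ D              ↭⟨ ++⁺ˡ xs (detachments-names ps) ⟩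
  xs ++ xs ++ namesᶜ ⟨ f ∣ Δ ⟩   ∎
  where
  open PermutationReasoning
  F = concatMap names f′
  D = concatMap namesᵉ Δ′
  O = concatMap names os

expansion-fresh : Expansion xs c G → Fresh xs (namesᶜ c)
expansion-fresh (expand _ _ fr) = fr

expansion-∈ : Expansion xs c G → x ∈ xs → x ∈ namesᶜ G
expansion-∈ ex x∈xs = ∈-resp-↭ (↭-sym (expansion-names ex)) (∈-++⁺ˡ x∈xs)

expansion-⊇ : Expansion xs c G → x ∈ namesᶜ c → x ∈ namesᶜ G
expansion-⊇ {xs} ex x∈c =
  ∈-resp-↭ (↭-sym (expansion-names ex)) (∈-++⁺ʳ xs (∈-++⁺ʳ xs x∈c))

expansion-∉ : Expansion xs c G → x ∉ xs → x ∉ namesᶜ c → x ∉ namesᶜ G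
expansion-∉ {xs} ex x∉xs x∉c x∈G with ∈-++⁻ xs (∈-resp-↭ (expansion-names ex) x∈G)
... | inj₁ x∈xs = x∉xs x∈xs
... | inj₂ x∈   = [ x∉xs , x∉c ] (∈-++⁻ xs x∈)

expansion-occurrences : ∀ z → Expansion xs c G → occurrences z (namesᶜ G) ≡
                        occurrences z xs + (occurrences z xs + occurrences z (namesᶜ c))
expansion-occurrences {xs} {c} {G} z ex = begin
  occurrences z (namesᶜ G)                 ≡⟨ occurrences-↭ z (expansion-names ex) ⟩
  occurrences z (xs ++ xs ++ namesᶜ c)     ≡⟨ occurrences-++ z xs _ ⟩
  occurrences z xs + occurrences z (xs ++ namesᶜ c)
    ≡⟨ cong (occurrences z xs +_) (occurrences-++ z xs _) ⟩
  occurrences z xs + (occurrences z xs + occurrences z (namesᶜ c)) ∎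
  where open ≡-Reasoning

expansion-new : Expansion xs c G → x ∈ xs → occurrences x (namesᶜ G) ≡ 2
expansion-new {x = x} ex x∈xs with expansion-fresh ex
... | unique , disjoint rewrite expansion-occurrences x ex | Unique⇒occurrences≡1 unique x∈xs
  | ∉⇒occurrences≡0 (disjoint x∈xs) = refl

expansion-old : Expansion xs c G → x ∉ xs → occurrences x (namesᶜ G) ≡ occurrences x (namesᶜ c)
expansion-old {x = x} ex x∉xs rewrite expansion-occurrences x ex | ∉⇒occurrences≡0 x∉xs = refl

expansion-linear : Expansion xs c G → Linear c → Linear G
expansion-linear {xs} ex lin x with x ∈? xs
... | yes x∈xs = ≤-reflexive (expansion-new ex x∈xs)
... | no x∉xs  = ≤-trans (≤-reflexive (expansion-old ex x∉xs)) (lin x)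

-- Commutation of expansions, and invariance under identification.

block-detach : ∀ {os os′ e} → Block xs os e → Detach y v (list term) os os′ →
               ∃[ e′ ] Block xs os′ e′ × Detach y v eqn e e′
block-detach wire  (head p)        = _ , wire  , rhs p
block-detach redex (head p)        = _ , redex , rhs (arg (tailᵛ (headᵛ p)))
block-detach redex (tail (head p)) = _ , redex , rhs (arg (headᵛ p))

-- The terms `os` sit inside the block equation, so a cut into one of them is a cut into that
-- equation; the block keeps its kind and names.
detachments-block : ∀ {o o′ os os′ e f f′ Δ Δ′} → Block xs os e →
                    Detachments (list term ⊗ config) ys (o , os , f , Δ) (o′ , os′ , f′ , Δ′) →
                    ∃[ e′ ] Block xs os′ e′ × Detachments config ys (o , f , e ∷ Δ) (o′ , f′ , e′ ∷ Δ′)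
detachments-block b [] = _ , b , []
detachments-block b (fst p ∷ ps) with detachments-block b ps
... | _ , b′ , ps′ = _ , b′ , fst p ∷ ps′
detachments-block b (snd (fst p) ∷ ps) with detachments-block b ps
... | _ , b′ , ps′ with block-detach b′ p
...   | _ , b″ , q = _ , b″ , snd (snd (head q)) ∷ ps′
detachments-block b (snd (snd (fst p)) ∷ ps) with detachments-block b ps
... | _ , b′ , ps′ = _ , b′ , snd (fst p) ∷ ps′
detachments-block b (snd (snd (snd p)) ∷ ps) with detachments-block b ps
... | _ , b′ , ps′ = _ , b′ , snd (snd (tail p)) ∷ ps′

-- The grid gives the same interface and remaining equations on both sides, with the two blocks
-- added in opposite orders. The hypothesis keeps `ys` apart from `c` and from `xs`, since `G₁`
-- contains the names of both.
expansion-join : Expansion xs c G₁ → Expansion ys c G₂ → (∀ {y} → y ∈ ys → y ∉ namesᶜ G₁) →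
                 ∃[ H₁ ] ∃[ H₂ ] Expansion ys G₁ H₁ × Expansion xs G₂ H₂ × H₁ ≋ H₂
expansion-join ex₁@(expand ps b fr₁@(unique₁ , _)) ex₂@(expand qs b′ (unique₂ , _)) apart
  with grid (detachments-snd ps) (detachments-snd qs)
... | _ , _ , _ , qs′ , ps′ with detachments-block b qs′ | detachments-block b′ ps′
...   | _ , b₁ , qs″ | _ , b₁′ , ps″ = _ , _ ,
  expand qs″ b₁′ (unique₂ , apart) ,
  expand ps″ b₁ (unique₁ , λ x∈xs → expansion-∉ ex₂
    (λ x∈ys → apart x∈ys (expansion-∈ ex₁ x∈xs)) (proj₂ fr₁ x∈xs)) ,
  ≋-permute (swap _ _ ↭refl)

block-rename : ∀ {os e} (ρ : Name → Name) → Block xs os e →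
               Block (map ρ xs) (map (subst (var ∘ ρ)) os) (substᵉ (var ∘ ρ) e)
block-rename ρ wire  = wire
block-rename ρ redex = redex

expansion-exchange : Expansion xs c G →
  Expansion (map (exchange x y) xs) (exchangeᶜ x y c) (exchangeᶜ x y G)
expansion-exchange {xs} {x = x} {y} (expand {f = f} {Δ = Δ} ps b (unique , disjoint)) =
  expand (detachments-rename ρ ps) (block-rename ρ b) (map⁺ injective unique , disjoint′)
  where
  ρ = exchange x y
  inv = exchange-involutive x y

  injective : ∀ {z w} → ρ z ≡ ρ w → z ≡ w
  injective {z} {w} eq = trans (sym (inv z)) (trans (cong ρ eq) (inv w))

  disjoint′ : ∀ {z} → z ∈ map ρ xs → z ∉ namesᶜ (exchangeᶜ x y ⟨ f ∣ Δ ⟩)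
  disjoint′ z∈ z∈′ with ∈-map⁻ ρ z∈
    | ∈-map⁻ ρ (transport (_ ∈_) (namesˢ-rename ρ config (f , Δ)) z∈′)
  ... | w , w∈xs , refl | w′ , w′∈ , eq =
    disjoint w∈xs (transport (_∈ _) (sym (injective eq)) w′∈)

-- New names occur twice in the expansion and not at all in `c`. Exchanging one with a fresh name is
-- thus an α-conversion of the expansion that leaves `c` as it is; the names of `l` are avoided one
-- by one.
refresh : Expansion xs c G → ∀ l →
          ∃[ ys ] ∃[ H ] Expansion ys c H × (∀ {y} → y ∈ ys → y ∉ l) × G ≋ H
refresh ex [] = _ , _ , ex , (λ _ ()) , ε
refresh {c = c} ex (a ∷ l) with refresh ex l
... | ys , H , ex′ , avoid , eq with a ∈? ys
...   | no a∉ys = ys , H , ex′ , avoid′ , eq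
  where
  avoid′ : ∀ {y} → y ∈ ys → y ∉ a ∷ l
  avoid′ y∈ys (here refl) = a∉ys y∈ys
  avoid′ y∈ys (there y∈l) = avoid y∈ys y∈l
-- `z` must avoid `H` for the α-conversion, and `a ∷ l` lest it bring back a forbidden name.
...   | yes a∈ys with fresh (namesᶜ H ++ a ∷ l)
...     | z , z∉ = map (exchange a z) ys , exchangeᶜ a z H ,
  transport (λ d → Expansion _ d _) (exchangeᶜ-fresh c (proj₂ (expansion-fresh ex′) a∈ys)
    (z∉H ∘ expansion-⊇ ex′)) (expansion-exchange ex′) ,
  avoid′ , eq ◅◅ step-≋ (exchanged (inj₁ (expansion-new ex′ a∈ys , z∉H)))
  where
  z∉H : z ∉ namesᶜ H
  z∉H = z∉ ∘ ∈-++⁺ˡ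

  exchange-avoids : ∀ {w} → w ∈ ys → Dec (w ≡ a) → exchange a z w ∉ a ∷ l
  exchange-avoids w∈ys (yes refl) rewrite exchange-left a z = z∉ ∘ ∈-++⁺ʳ (namesᶜ H)
  exchange-avoids w∈ys (no w≢a)
    rewrite exchange-other {a} {z} w≢a (λ { refl → z∉H (expansion-∈ ex′ w∈ys) }) =
    λ { (here w≡a) → w≢a w≡a ; (there w∈l) → avoid w∈ys w∈l }

  avoid′ : ∀ {y} → y ∈ map (exchange a z) ys → y ∉ a ∷ l
  avoid′ y∈ with ∈-map⁻ (exchange a z) y∈
  ... | w , w∈ys , refl = exchange-avoids w∈ys (w ≟ a)

expansion-step : Step c d → Expansion xs c G → ∃[ ys ] ∃[ H ] Expansion ys d H × G ≋ H
expansion-step (rearranged eq) (expand {e = e} ps b (unique , disjoint))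
  with detachments-rearrange eq ps
... | _ , eq′ , ps′ = _ , _ ,
  expand ps′ b (unique , λ x∈xs → disjoint x∈xs ∘ ∈-resp-↭ (↭-sym (rearranged-names eq))) ,
  under e eq′
  where
  under : ∀ e {c d} → Rearranged c d →
          ⟨ proj₁ c ∣ e ∷ proj₂ c ⟩ ≋ ⟨ proj₁ d ∣ e ∷ proj₂ d ⟩
  under e (permute eq) = ≋-permute (prep e eq)
  under e flip         = ≋-flip (e ∷ [])
-- Once the new names are moved away from `x` and `y`, these two occur in the expansion as often as
-- in `c`, so the exchange is an α-conversion there too.
expansion-step (exchanged {c} {x} {y} bf) ex with refresh ex (x ∷ y ∷ [])
... | ys , H , ex′ , avoid , eq = _ , _ , expansion-exchange ex′ ,
  eq ◅◅ step-≋ (exchanged (bound-fresh bf))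
  where
  x∉ys : x ∉ ys
  x∉ys x∈ys = avoid x∈ys (here refl)

  y∉ys : y ∉ ys
  y∉ys y∈ys = avoid y∈ys (there (here refl))

  bound-fresh : BoundFresh x y c ⊎ BoundFresh y x c → BoundFresh x y H ⊎ BoundFresh y x H
  bound-fresh (inj₁ (twice , y∉c)) =
    inj₁ (trans (expansion-old ex′ x∉ys) twice , expansion-∉ ex′ y∉ys y∉c)
  bound-fresh (inj₂ (twice , x∉c)) =
    inj₂ (trans (expansion-old ex′ y∉ys) twice , expansion-∉ ex′ x∉ys x∉c)

expansion-≋ : c ≋ d → Expansion xs c G → ∃[ ys ] ∃[ H ] Expansion ys d H × G ≋ H
expansion-≋ ε        ex = _ , _ , ex , ε
expansion-≋ (s ◅ ss) ex with expansion-step (≈ᵖ-step s) ex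
... | _ , _ , ex′ , eq with expansion-≋ ss ex′
...   | _ , _ , ex″ , eq′ = _ , _ , ex″ , eq ◅◅ eq′

-- Confluence of expansion.

infix 4 _⇗_ _⇗*_

-- At most one expansion, modulo `_≋_`. Allowing none lets the diamond close with single steps even
-- when one side is a mere identification, so that plain tiling gives confluence.
data _⇗_ (c G : PreConfiguration) : Set where
  still : c ≋ G → c ⇗ G
  grow  : Expansion xs c H → H ≋ G → c ⇗ G

_⇗*_ : PreConfiguration → PreConfiguration → Set
_⇗*_ = Star _⇗_

⇗-diamond : c ⇗ G₁ → c ⇗ G₂ → ∃[ H ] G₁ ⇗ H × G₂ ⇗ H
⇗-diamond (still eq₁) (still eq₂) = _ , still (≋-sym eq₁ ◅◅ eq₂) , still ε
⇗-diamond (still eq₁) (grow ex eq₂) with expansion-≋ eq₁ ex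
... | _ , _ , ex′ , eq = _ , grow ex′ (≋-sym eq ◅◅ eq₂) , still ε
⇗-diamond (grow ex eq₁) (still eq₂) with expansion-≋ eq₂ ex
... | _ , _ , ex′ , eq = _ , still ε , grow ex′ (≋-sym eq ◅◅ eq₁)
-- The names of the second expansion are first renamed away from the first result; after the join,
-- both further expansions are carried along the pending identifications.
⇗-diamond (grow {H = K₁} ex₁ eq₁) (grow ex₂ eq₂) with refresh ex₂ (namesᶜ K₁)
... | _ , _ , ex₂′ , apart , eq with expansion-join ex₁ ex₂′ apart
...   | _ , _ , up₁ , up₂ , eq′
  with expansion-≋ eq₁ up₁ | expansion-≋ (≋-sym eq ◅◅ eq₂) up₂
...     | _ , _ , up₁′ , eq₁′ | _ , _ , up₂′ , eq₂′ =
  _ , grow up₁′ ε , grow up₂′ (≋-sym eq₂′ ◅◅ ≋-sym eq′ ◅◅ eq₁′)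

⇗-strip : c ⇗ G₁ → c ⇗* G₂ → ∃[ H ] G₁ ⇗* H × G₂ ⇗ H
⇗-strip r ε        = _ , ε , r
⇗-strip r (q ◅ qs) with ⇗-diamond r q
... | _ , q′ , r′ with ⇗-strip r′ qs
...   | _ , qs′ , r″ = _ , q′ ◅ qs′ , r″

⇗-confluent : Confluent _⇗_
⇗-confluent ε        qs = _ , qs , ε
⇗-confluent (r ◅ rs) qs with ⇗-strip r qs
... | _ , qs′ , r′ with ⇗-confluent rs qs′
...   | _ , qs″ , rs′ = _ , qs″ , r′ ◅ rs′

Joinable : PreConfiguration → PreConfiguration → Set
Joinable c d = ∃[ G ] c ⇗* G × d ⇗* G

-- Confluence at the middle configuration `d` merges its two expansions; this is what allows zigzags
-- of reductions to be handled step by step.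
joinable-trans : ∀ {e} → Joinable c d → Joinable d e → Joinable c e
joinable-trans (_ , c⇗ , d⇗) (_ , d⇗′ , e⇗) with ⇗-confluent d⇗ d⇗′
... | _ , up , up′ = _ , c⇗ ◅◅ up , e⇗ ◅◅ up′

-- Expansions reduce back to what they expand.

configuration : ∀ c → Linear c → Configuration
configuration c c-lin = record { pre = c ; atMostTwice = c-lin }

-- Expansions live on preconfigurations, reductions on configurations with linearity proofs.
-- Quantifying over the proofs at both ends bridges the two.
_↠_ : PreConfiguration → PreConfiguration → Set
c ↠ d = (c-lin : Linear c) (d-lin : Linear d) → configuration c c-lin ⟶* configuration d d-lin

≋⇒↠ : c ≋ d → c ↠ d
≋⇒↠ eq c-lin d-lin = inj₁ (≋⇒≈ eq c-lin d-lin) ◅ ε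

expand-wire : ∀ {f′ Δ′} → Detach x u config (f , Δ) (f′ , Δ′) → x ∉ namesᶜ ⟨ f ∣ Δ ⟩ →
              Expansion (x ∷ []) ⟨ f ∣ Δ ⟩ ⟨ f′ ∣ (var x ≐ u) ∷ Δ′ ⟩
expand-wire p x∉c = expand (snd p ∷ []) wire ([] ∷ [] , λ { (here refl) → x∉c })

-- Filling the hole is an indirection. Its side conditions come from counting names: those of `u`
-- all occur in the original configuration, where `x` is fresh, and the hole is an occurrence of `x`
-- outside the equation.
wire-sound : ∀ {f′ Δ′} → Detach x u config (f , Δ) (f′ , Δ′) → x ∉ namesᶜ ⟨ f ∣ Δ ⟩ →
             ⟨ f′ ∣ (var x ≐ u) ∷ Δ′ ⟩ ↠ ⟨ f ∣ Δ ⟩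
wire-sound {x} {u} {f} {Δ} {f′} {Δ′} p x∉c _ _ with detach-names p
... | r , eq , eq′ = inj₂ (transport (⟨ f′ ∣ (var x ≐ u) ∷ Δ′ ⟩ ⟶ᵖ_)
  (cong assemble (detach-restore x∉c p))
  (indirection x u (λ x∈u → x∉c (∈-resp-↭ (↭-sym eq) (∈-++⁺ˡ x∈u)))
    (∈-resp-↭ (↭-sym eq′) (here refl)))) ◅ ε

ruleRenaming : Name → Name → Name → Name
ruleRenaming p q zero    = p
ruleRenaming p q (suc _) = q

ruleRenaming-fresh : ∀ {p q} → p ∉ namesᶜ c → q ∉ p ∷ namesᶜ c →
                     FreshRenaming linearRule c (ruleRenaming p q)
ruleRenaming-fresh {c} {p} {q} p∉ q∉ = record
  { injective = λ x∈ y∈ → injective (zero-or-one x∈) (zero-or-one y∈)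
  ; fresh     = λ x∈ → avoids (zero-or-one x∈)
  }
  where
  ρ = ruleRenaming p q

  zero-or-one : x ∈ Rule.ruleNames linearRule → x ≡ 0 ⊎ x ≡ 1
  zero-or-one (here eq)                         = inj₁ eq
  zero-or-one (there (here eq))                 = inj₂ eq
  zero-or-one (there (there (here eq)))         = inj₁ eq
  zero-or-one (there (there (there (here eq)))) = inj₂ eq

  injective : x ≡ 0 ⊎ x ≡ 1 → y ≡ 0 ⊎ y ≡ 1 → ρ x ≡ ρ y → x ≡ y
  injective (inj₁ refl) (inj₁ refl) _   = refl
  injective (inj₁ refl) (inj₂ refl) p≡q = ⊥-elim (≢-head q∉ (sym p≡q))
  injective (inj₂ refl) (inj₁ refl) q≡p = ⊥-elim (≢-head q∉ q≡p)
  injective (inj₂ refl) (inj₂ refl) _   = refl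

  avoids : x ≡ 0 ⊎ x ≡ 1 → ρ x ∉ namesᶜ c
  avoids (inj₁ refl) = p∉
  avoids (inj₂ refl) = ∉-tail q∉

interaction-sound′ : ∀ {p q} →
  let G = ⟨ f ∣ (var x ＠ var y ≐ u ƛ v) ∷ Δ ⟩
      c = ⟨ f ∣ (var y ≐ v) ∷ (var x ≐ u) ∷ Δ ⟩ in
  p ∉ namesᶜ G ++ namesᶜ c → q ∉ p ∷ namesᶜ G ++ namesᶜ c → G ↠ c
interaction-sound′ {f} {x} {y} {u} {v} {Δ} {p} {q} p∉ q∉ c-lin d-lin =
  -- The interaction wires the ports to `p` and `q`. Up to order and orientation the result is `c₂`,
  -- that is, `c₀` with `u` and `v` detached under these names; two indirections lead to `c₀`.
  inj₂ (interaction tt (var x ∷ var y ∷ []) (u ∷ v ∷ []) (ruleRenaming p q)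
         (ruleRenaming-fresh (p∉ ∘ ∈-++⁺ˡ) (∉-∷ (≢-head q∉) (∉-tail q∉ ∘ ∈-++⁺ˡ)))) ◅
  ≋⇒↠ rearrangement (≋-linear (≋-sym rearrangement) lin₂) lin₂ ◅◅
  wire-sound detach₂ q∉₁ lin₂ lin₁ ◅◅
  wire-sound detach₁ p∉₀ lin₁ d-lin
  where
  c₀ c₁ c₂ : PreConfiguration
  c₀ = ⟨ f ∣ (var y ≐ v) ∷ (var x ≐ u) ∷ Δ ⟩
  c₁ = ⟨ f ∣ (var p ≐ u) ∷ (var y ≐ v) ∷ (var x ≐ var p) ∷ Δ ⟩
  c₂ = ⟨ f ∣ (var q ≐ v) ∷ (var p ≐ u) ∷ (var y ≐ var q) ∷ (var x ≐ var p) ∷ Δ ⟩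

  detach₁ : Detach p u config (parts c₀) (f , (var y ≐ v) ∷ (var x ≐ var p) ∷ Δ)
  detach₁ = snd (tail (head (rhs here)))

  detach₂ : Detach q v config (parts c₁) (f , (var p ≐ u) ∷ (var y ≐ var q) ∷ (var x ≐ var p) ∷ Δ)
  detach₂ = snd (tail (head (rhs here)))

  p∉₀ : p ∉ namesᶜ c₀
  p∉₀ = p∉ ∘ ∈-++⁺ʳ (namesᶜ ⟨ f ∣ (var x ＠ var y ≐ u ƛ v) ∷ Δ ⟩)

  q∉₁ : q ∉ namesᶜ c₁
  q∉₁ = expansion-∉ (expand-wire detach₁ p∉₀) (∉-∷ (≢-head q∉) λ ())
    (∉-tail q∉ ∘ ∈-++⁺ʳ (namesᶜ ⟨ f ∣ (var x ＠ var y ≐ u ƛ v) ∷ Δ ⟩))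

  lin₁ : Linear c₁
  lin₁ = expansion-linear (expand-wire detach₁ p∉₀) d-lin

  lin₂ : Linear c₂
  lin₂ = expansion-linear (expand-wire detach₂ q∉₁) lin₁

  rearrangement : ⟨ f ∣ (var x ≐ var p) ∷ (var y ≐ var q) ∷ (u ≐ var p) ∷ (v ≐ var q) ∷ Δ ⟩ ≋ c₂
  rearrangement =
    ≋-permute (++⁺ʳ Δ (↭-sym (↭-reverse
      ((var x ≐ var p) ∷ (var y ≐ var q) ∷ (u ≐ var p) ∷ (v ≐ var q) ∷ [])))) ◅◅
    ≋-flip [] ◅◅ ≋-flip (_ ∷ [])

interaction-sound :
  ⟨ f ∣ (var x ＠ var y ≐ u ƛ v) ∷ Δ ⟩ ↠ ⟨ f ∣ (var y ≐ v) ∷ (var x ≐ u) ∷ Δ ⟩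
interaction-sound {f} {x} {y} {u} {v} {Δ} =
  interaction-sound′ (proj₁ (proj₂ (proj₂ pq))) (proj₂ (proj₂ (proj₂ pq)))
  where pq = fresh₂ (namesᶜ ⟨ f ∣ (var x ＠ var y ≐ u ƛ v) ∷ Δ ⟩ ++
                     namesᶜ ⟨ f ∣ (var y ≐ v) ∷ (var x ≐ u) ∷ Δ ⟩)

expansion-sound : Expansion xs c G → G ↠ c
expansion-sound (expand (snd p ∷ []) wire (_ , disjoint)) =
  wire-sound p (disjoint (here refl))
-- A `redex` block interacts to the equations that two successive wires would have added; these are
-- then undone, the later one first.
expansion-sound {c = c} (expand {f′ = f₂} {Δ′ = Δ₂}
  (_∷_ {x = y} {u = v} {o = u₀ ∷ []} {o′ = u ∷ []} {a = f₁ , Δ₁} q (_∷_ {x = x} (snd p) []))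
  redex ((y≢x ∷ _) ∷ _ , disjoint)) G-lin c-lin =
  interaction-sound G-lin lin₂ ◅◅ wire-sound q′ y∉₁ lin₂ lin₁ ◅◅ wire-sound p x∉c lin₁ c-lin
  where
  x∉c : x ∉ namesᶜ c
  x∉c = disjoint (there (here refl))

  -- The second detachment may cut into the first detached term, which is now the right-hand side of
  -- the equation for `x`.
  pending : Detach y v (list term ⊗ config) (u₀ ∷ [] , f₁ , Δ₁) (u ∷ [] , f₂ , Δ₂) →
            Detach y v config (f₁ , (var x ≐ u₀) ∷ Δ₁) (f₂ , (var x ≐ u) ∷ Δ₂)
  pending (fst (head p)) = snd (head (rhs p))
  pending (snd (fst p))  = fst p
  pending (snd (snd p))  = snd (tail p)

  q′ = pending q

  y∉₁ : y ∉ namesᶜ ⟨ f₁ ∣ (var x ≐ u₀) ∷ Δ₁ ⟩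
  y∉₁ = expansion-∉ (expand-wire p x∉c) (∉-∷ y≢x λ ()) (disjoint (here refl))

  lin₁ : Linear ⟨ f₁ ∣ (var x ≐ u₀) ∷ Δ₁ ⟩
  lin₁ = expansion-linear (expand-wire p x∉c) c-lin

  lin₂ : Linear ⟨ f₂ ∣ (var y ≐ v) ∷ (var x ≐ u) ∷ Δ₂ ⟩
  lin₂ = expansion-linear (expand-wire q′ y∉₁) lin₁

⇗*-linear : c ⇗* G → Linear c → Linear G
⇗*-linear ε                 lin = lin
⇗*-linear (still eq ◅ up)   lin = ⇗*-linear up (≋-linear eq lin)
⇗*-linear (grow ex eq ◅ up) lin = ⇗*-linear up (≋-linear eq (expansion-linear ex lin))

⇗*-sound : c ⇗* G → G ↠ c
⇗*-sound ε G-lin c-lin = ≋⇒↠ ε G-lin c-lin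
⇗*-sound (still eq ◅ up) G-lin c-lin =
  ⇗*-sound up G-lin lin ◅◅ ≋⇒↠ (≋-sym eq) lin c-lin
  where lin = ≋-linear eq c-lin
⇗*-sound (grow ex eq ◅ up) G-lin c-lin =
  ⇗*-sound up G-lin lin ◅◅ ≋⇒↠ (≋-sym eq) lin lin-H ◅◅ expansion-sound ex lin-H c-lin
  where
  lin-H = expansion-linear ex c-lin
  lin = ≋-linear eq lin-H

-- Common expansions for reduction steps.

expansion-⇗ : Expansion xs c G → c ⇗* G
expansion-⇗ ex = grow ex ε ◅ ε

-- The configuration before the step already is an expansion of the one after it. Linearity leaves
-- exactly one occurrence of `x` outside the equation, and the substitution fills just that hole.
indirection-joinable :
  ∀ x u → Linear ⟨ f ∣ (var x ≐ u) ∷ Δ ⟩ → x ∉ names u → x ∈ namesᶜ ⟨ f ∣ Δ ⟩ →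
  Joinable ⟨ f ∣ (var x ≐ u) ∷ Δ ⟩ (substᶜ (x ↦ u) ⟨ f ∣ Δ ⟩)
indirection-joinable {f} {Δ} x u lin x∉u x∈ = _ , ε , expansion-⇗ (expand-wire p x∉c)
  where
  n = occurrences x (namesᶜ ⟨ f ∣ Δ ⟩)

  split : occurrences x (namesᶜ ⟨ f ∣ (var x ≐ u) ∷ Δ ⟩) ≡ suc n
  split = begin
    occurrences x (namesᶜ ⟨ f ∣ (var x ≐ u) ∷ Δ ⟩)
      ≡⟨ occurrences-↭ x (shifts (concatMap names f) (x ∷ names u)) ⟩
    occurrences x (x ∷ names u ++ namesᶜ ⟨ f ∣ Δ ⟩)
      ≡⟨ occurrences-here x _ ⟩
    suc (occurrences x (names u ++ namesᶜ ⟨ f ∣ Δ ⟩))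
      ≡⟨ cong suc (occurrences-++ x (names u) _) ⟩
    suc (occurrences x (names u) + n)
      ≡⟨ cong (λ k → suc (k + n)) (∉⇒occurrences≡0 x∉u) ⟩
    suc n ∎
    where open ≡-Reasoning

  exactly-one : ∀ k → k ≢ 0 → suc k ≤ 2 → k ≡ 1
  exactly-one zero          k≢0 _                 = ⊥-elim (k≢0 refl)
  exactly-one (suc zero)    _   _                 = refl
  exactly-one (suc (suc _)) _   (s≤s (s≤s ()))

  once : n ≡ 1
  once = exactly-one n (λ n≡0 → occurrences≡0⇒∉ n≡0 x∈)
    (≤-trans (≤-reflexive (sym split)) (lin x))

  p : Detach x u config (substˢ config (x ↦ u) (f , Δ)) (f , Δ)
  p = detach-of-once config (f , Δ) once

  -- The hole accounts for the one occurrence of `x`, so the rest `r` contains none.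
  x∉c : x ∉ namesᶜ (substᶜ (x ↦ u) ⟨ f ∣ Δ ⟩)
  x∉c x∈c with detach-names p
  ... | r , eq , eq′ with ∈-++⁻ (names u) (∈-resp-↭ eq x∈c)
  ...   | inj₁ x∈u = x∉u x∈u
  ...   | inj₂ x∈r = occurrences≡0⇒∉ (suc-injective (begin
    suc (occurrences x r)     ≡⟨ occurrences-here x r ⟨
    occurrences x (x ∷ r)     ≡⟨ occurrences-↭ x eq′ ⟨
    n                         ≡⟨ once ⟩
    1                         ∎)) x∈r
    where open ≡-Reasoning

-- The common ancestor is the active pair with all four auxiliary ports
-- detached: a₁, a₂ being the bound names of the reduct, which now name the
-- ports of the abstraction.
interaction-joinable′ :
  ∀ {f Δ t₁ t₂ u₁ u₂ a₁ a₂ b₁ b₂} →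
  let active = ⟨ f ∣ (t₁ ＠ t₂ ≐ u₁ ƛ u₂) ∷ Δ ⟩
      reduct = ⟨ f ∣ (t₁ ≐ var a₁) ∷ (t₂ ≐ var a₂) ∷ (u₁ ≐ var a₁) ∷ (u₂ ≐ var a₂) ∷ Δ ⟩
      used   = a₁ ∷ a₂ ∷ namesᶜ active ++ namesᶜ reduct in
  a₁ ∉ namesᶜ active → a₂ ∉ a₁ ∷ namesᶜ active → b₁ ∉ used → b₂ ∉ b₁ ∷ used →
  Joinable active reduct
interaction-joinable′ {f} {Δ} {t₁} {t₂} {u₁} {u₂} {a₁} {a₂} {b₁} {b₂} a₁∉ a₂∉ b₁∉ b₂∉ = _ ,
  expansion-⇗ ex₁ ◅◅ expansion-⇗ ex₂ ◅◅ expansion-⇗ ex₃ ◅◅ expansion-⇗ ex₄ ◅◅ still rearrangement ◅ ε ,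
  expansion-⇗ ex
  where
  active reduct : PreConfiguration
  active = ⟨ f ∣ (t₁ ＠ t₂ ≐ u₁ ƛ u₂) ∷ Δ ⟩
  reduct = ⟨ f ∣ (t₁ ≐ var a₁) ∷ (t₂ ≐ var a₂) ∷ (u₁ ≐ var a₁) ∷ (u₂ ≐ var a₂) ∷ Δ ⟩

  b₁∉active : b₁ ∉ namesᶜ active
  b₁∉active = ∉-tail (∉-tail b₁∉) ∘ ∈-++⁺ˡ

  b₂∉active : b₂ ∉ namesᶜ active
  b₂∉active = ∉-tail (∉-tail (∉-tail b₂∉)) ∘ ∈-++⁺ˡ

  -- Four wires empty the active pair. The ports of λ get the names `a₁` and `a₂` of the reduct,
  -- those of @ get new ones.
  ex₁ : Expansion (a₁ ∷ []) active ⟨ f ∣ (var a₁ ≐ u₁) ∷ (t₁ ＠ t₂ ≐ var a₁ ƛ u₂) ∷ Δ ⟩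
  ex₁ = expand-wire (snd (head (rhs (arg (headᵛ here))))) a₁∉

  ex₂ : Expansion (a₂ ∷ []) _
    ⟨ f ∣ (var a₂ ≐ u₂) ∷ (var a₁ ≐ u₁) ∷ (t₁ ＠ t₂ ≐ var a₁ ƛ var a₂) ∷ Δ ⟩
  ex₂ = expand-wire (snd (tail (head (rhs (arg (tailᵛ (headᵛ here)))))))
    (expansion-∉ ex₁ (∉-∷ (≢-head a₂∉) λ ()) (∉-tail a₂∉))

  ex₃ : Expansion (b₁ ∷ []) _
    ⟨ f ∣ (var b₁ ≐ t₁) ∷ (var a₂ ≐ u₂) ∷ (var a₁ ≐ u₁) ∷
          (var b₁ ＠ t₂ ≐ var a₁ ƛ var a₂) ∷ Δ ⟩
  ex₃ = expand-wire (snd (tail (tail (head (lhs (arg (headᵛ here)))))))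
    (expansion-∉ ex₂ (∉-∷ (≢-head (∉-tail b₁∉)) λ ())
      (expansion-∉ ex₁ (∉-∷ (≢-head b₁∉) λ ()) b₁∉active))

  ex₄ : Expansion (b₂ ∷ []) _
    ⟨ f ∣ (var b₂ ≐ t₂) ∷ (var b₁ ≐ t₁) ∷ (var a₂ ≐ u₂) ∷ (var a₁ ≐ u₁) ∷
          (var b₁ ＠ var b₂ ≐ var a₁ ƛ var a₂) ∷ Δ ⟩
  ex₄ = expand-wire (snd (tail (tail (tail (head (lhs (arg (tailᵛ (headᵛ here)))))))))
    (expansion-∉ ex₃ (∉-∷ (≢-head b₂∉) λ ())
      (expansion-∉ ex₂ (∉-∷ (≢-head (∉-tail (∉-tail b₂∉))) λ ())
        (expansion-∉ ex₁ (∉-∷ (≢-head (∉-tail b₂∉)) λ ()) b₂∉active)))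

  -- From the reduct, the terms detached are the right-hand sides `var a₁` and `var a₂` of the first
  -- two equations; the `redex` block puts them under the abstraction and so recreates the emptied
  -- active pair.
  ex : Expansion (b₂ ∷ b₁ ∷ []) reduct
    ⟨ f ∣ (var b₁ ＠ var b₂ ≐ var a₁ ƛ var a₂) ∷
          (t₁ ≐ var b₁) ∷ (t₂ ≐ var b₂) ∷ (u₁ ≐ var a₁) ∷ (u₂ ≐ var a₂) ∷ Δ ⟩
  ex = expand
    (snd (snd (tail (head (rhs here)))) ∷ (snd (snd (head (rhs here))) ∷ [])) redex
    ( (≢-head b₂∉ ∷ []) ∷ [] ∷ []
    , λ { (here refl)         → ∉-tail (∉-tail (∉-tail b₂∉)) ∘ ∈-++⁺ʳ (namesᶜ active)
        ; (there (here refl)) → ∉-tail (∉-tail b₁∉) ∘ ∈-++⁺ʳ (namesᶜ active) })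

  rearrangement :
    ⟨ f ∣ (var b₂ ≐ t₂) ∷ (var b₁ ≐ t₁) ∷ (var a₂ ≐ u₂) ∷ (var a₁ ≐ u₁) ∷
          (var b₁ ＠ var b₂ ≐ var a₁ ƛ var a₂) ∷ Δ ⟩ ≋
    ⟨ f ∣ (var b₁ ＠ var b₂ ≐ var a₁ ƛ var a₂) ∷
          (t₁ ≐ var b₁) ∷ (t₂ ≐ var b₂) ∷ (u₁ ≐ var a₁) ∷ (u₂ ≐ var a₂) ∷ Δ ⟩
  rearrangement =
    ≋-flip [] ◅◅ ≋-flip (_ ∷ []) ◅◅ ≋-flip (_ ∷ _ ∷ []) ◅◅ ≋-flip (_ ∷ _ ∷ _ ∷ []) ◅◅
    ≋-permute (↭-trans (swap _ _ (swap _ _ ↭refl)) (shift _ (_ ∷ _ ∷ _ ∷ _ ∷ []) Δ))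

interaction-joinable : ∀ {f Δ t₁ t₂ u₁ u₂ a₁ a₂} →
  let active = ⟨ f ∣ (t₁ ＠ t₂ ≐ u₁ ƛ u₂) ∷ Δ ⟩ in
  a₁ ∉ namesᶜ active → a₂ ∉ a₁ ∷ namesᶜ active →
  Joinable active
    ⟨ f ∣ (t₁ ≐ var a₁) ∷ (t₂ ≐ var a₂) ∷ (u₁ ≐ var a₁) ∷ (u₂ ≐ var a₂) ∷ Δ ⟩
interaction-joinable {f} {Δ} {t₁} {t₂} {u₁} {u₂} {a₁} {a₂} a₁∉ a₂∉ =
  interaction-joinable′ {f} {Δ} {t₁} {t₂} {u₁} {u₂} a₁∉ a₂∉
    (proj₁ (proj₂ (proj₂ bs))) (proj₂ (proj₂ (proj₂ bs)))
  where
  bs = fresh₂ (a₁ ∷ a₂ ∷ namesᶜ ⟨ f ∣ (t₁ ＠ t₂ ≐ u₁ ƛ u₂) ∷ Δ ⟩ ++ namesᶜ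
    ⟨ f ∣ (t₁ ≐ var a₁) ∷ (t₂ ≐ var a₂) ∷ (u₁ ≐ var a₁) ∷ (u₂ ≐ var a₂) ∷ Δ ⟩)

⟶-joinable : c ⟶ᵖ d → Linear c → Joinable c d
⟶-joinable (interaction tt (t₁ ∷ t₂ ∷ []) (u₁ ∷ u₂ ∷ []) ρ fr) _ =
  interaction-joinable (fresh′ (here refl))
    (∉-∷ (λ eq → 1≢0 (injective (there (here refl)) (here refl) eq)) (fresh′ (there (here refl))))
  where
  open FreshRenaming fr renaming (fresh to fresh′)
  1≢0 : 1 ≢ 0
  1≢0 ()
⟶-joinable (indirection x u x∉u x∈) lin = indirection-joinable x u lin x∉u x∈

-- Joinability is symmetric, so it forgets the direction of the steps, and transitivity composes
-- them.
⟶*-joinable : {s t : Configuration} → s ⟶* t → Joinable (pre s) (pre t)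
⟶*-joinable ε = _ , ε , ε
⟶*-joinable (inj₁ eq ◅ steps) =
  joinable-trans (_ , still (gmap pre id eq) ◅ ε , ε) (⟶*-joinable steps)
⟶*-joinable {s} (inj₂ step ◅ steps) =
  joinable-trans (⟶-joinable step (Configuration.atMostTwice s)) (⟶*-joinable steps)

proposition10 : UpwardConfluent linearLambda
proposition10 s₁ s₂ s s₁⟶s s₂⟶s
  with ⟶*-joinable s₁⟶s | ⟶*-joinable s₂⟶s
-- The two joinabilities meet at `s`, the second one reversed by swapping its components. The
-- resulting common expansion `G` is the ancestor sought.
... | _ , up₁ , up | _ , up₂ , up′ with joinable-trans (_ , up₁ , up) (_ , up′ , up₂)
...   | G , s₁⇗G , s₂⇗G = configuration G G-lin ,
  ⇗*-sound s₁⇗G G-lin (Configuration.atMostTwice s₁) ,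
  ⇗*-sound s₂⇗G G-lin (Configuration.atMostTwice s₂)
  where
  G-lin : Linear G
  G-lin = ⇗*-linear s₁⇗G (Configuration.atMostTwice s₁)
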